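{- Let $S$ be a nontrivial proper subgroup of $\mathbb{Q}$, let $u,v\in\mathbb{N}$, and let $A$ be a $u\times v$ matrix with rational entries that is weakly image partition regular over $S$ and has linearly dependent rows. Then there exist $j<u$ and a $(j+u)\times 3u$ matrix $D$ (with rational entries) that is kernel partition regular over $S$ such that, whenever $\vec s\in(S\setminus\{0\})^{3u}$ and $D\vec s=\vec 0$, there exists $\vec y\in S^v\setminus\{\vec 0\}$ such that all entries of $A\vec y$ are entries of $\vec s$.
   Context: $\mathbb{N}$ is the set of positive integers; nontrivial means $\neq\{0\}$. A finite colouring is a function with finite range; monochromatic means constant colour. $A$ is weakly image partition regular over $S$ (a group) if for every finite colouring of $S\setminus\{0\}$ there is $\vec x\in S^v$ with the entries of $A\vec x$ in $S\setminus\{0\}$ and monochromatic. A matrix $M$ with $w$ columns is kernel partition regular over $S$ if for every finite colouring of $S\setminus\{0\}$ there is $\vec x\in(S\setminus\{0\})^w$ with $M\vec x=\vec 0$ and the entries of $\vec x$ monochromatic. -}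

module Defs where

open import Data.Nat using (ℕ; zero; suc)
open import Data.Fin using (Fin; zero; suc)
open import Data.Rational using (ℚ; 0ℚ; _+_; _*_; -_)
open import Data.Product using (Σ; ∃; _×_; _,_)
open import Relation.Binary.PropositionalEquality using (_≡_; _≢_)
open import Relation.Nullary using (¬_)

record IsSubgroup (S : ℚ → Set) : Set where
  field
    zero∈ : S 0ℚ
    +-closed : ∀ {x y} → S x → S y → S (x + y)
    neg-closed : ∀ {x} → S x → S (- x)

Nontrivial : (ℚ → Set) → Set
Nontrivial S = Σ ℚ λ x → S x × x ≢ 0ℚ

Proper : (ℚ → Set) → Set
Proper S = Σ ℚ λ x → ¬ S x

Matrix : ℕ → ℕ → Set
Matrix m n = Fin m → Fin n → ℚ

QVec : ℕ → Set
QVec n = Fin n → ℚ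

sumFin : ∀ n → (Fin n → ℚ) → ℚ
sumFin zero f = 0ℚ
sumFin (suc n) f = f zero + sumFin n (λ i → f (suc i))

_·_ : ∀ {m n} → Matrix m n → QVec n → QVec m
_·_ {n = n} A x i = sumFin n (λ j → A i j * x j)

S∖0 : (ℚ → Set) → Set
S∖0 S = Σ ℚ λ x → S x × x ≢ 0ℚ

Colouring : (ℚ → Set) → ℕ → Set
Colouring S k = S∖0 S → Fin k

MonoIn : ∀ (S : ℚ → Set) {k m} → Colouring S k → QVec m → Set
MonoIn S {k} {m} c z = Σ (Fin k) λ col → ∀ (i : Fin m) →
  Σ (S (z i)) λ p → Σ (z i ≢ 0ℚ) λ q → c (z i , p , q) ≡ col

WeaklyIPR : (ℚ → Set) → ∀ {u v} → Matrix u v → Set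
WeaklyIPR S {u} {v} A = ∀ (k : ℕ) (c : Colouring S k) →
  Σ (QVec v) λ x → (∀ j → S (x j)) × MonoIn S c (A · x)

KernelPR : (ℚ → Set) → ∀ {m w} → Matrix m w → Set
KernelPR S {m} {w} M = ∀ (k : ℕ) (c : Colouring S k) →
  Σ (QVec w) λ x → (∀ i → (M · x) i ≡ 0ℚ) × MonoIn S c x

RowsDependent : ∀ {u v} → Matrix u v → Set
RowsDependent {u} {v} A = Σ (QVec u) λ a → (Σ (Fin u) λ i → a i ≢ 0ℚ) ×
  (∀ j → sumFin u (λ i → a i * A i j) ≡ 0ℚ)

{-# OPTIONS --safe #-}
-- Colour each nonzero rational by the last nonzero base-p digits of its numerator and denominator, for a prime p
-- avoiding finitely many denominators attached to A.  Sorting the entries of a monochromatic image A x by p-adic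
-- valuation, and lifting from residues mod p to ℚ by the Fredholm alternative, gives vectors Y_t over ℚ such that
-- every row of the matrix (A Y_t)_t has first nonzero entry 1 (this is Rado's columns condition).  After column
-- reduction this matrix contains an identity submatrix, in rows rep t, so its column space is cut out by u - 1
-- equations z_k = Σ_t (A Y_t)_k z_(rep t).  These, together with z_i = d (x_i - y_i) for a common denominator d of
-- the Y_t, form D: for a solution z, the vector Σ_t z_(rep t) Y_t has entries in S and is mapped to z by A.
-- Conversely the solutions of D contain the image of a matrix whose rows have first nonzero entry 1, and such
-- matrices are image partition regular over any nontrivial subgroup, by van der Waerden's theorem and Deuber's
-- construction.
module Submission where

open import Defs
open import Level using (0ℓ)
open import Data.Nat as ℕ using (ℕ; zero; suc)
open import Data.Nat.Divisibility using (_∣_; divides; _∣?_; m∣m*n; ∣1⇒≡1; ∣m+n∣m⇒∣n; ∣-trans)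
open import Data.Nat.Induction using (<-rec)
open import Data.Nat.ListAction using (product)
open import Data.Nat.ListAction.Properties using (∈⇒∣product; product≢0)
open import Data.Nat.Primality using (Prime; euclidsLemma; prime⇒nonZero; prime⇒nonTrivial; ¬prime[1])
open import Data.Nat.Primality.Factorisation using (factorise)
import Data.Nat.Properties as ℕ
open import Data.Integer as ℤ using (ℤ; +_; -[1+_]; ∣_∣)
open import Data.Integer.DivMod using (_%ℕ_; _/ℕ_; n%ℕd<d; a≡a%ℕn+[a/ℕn]*n)
import Data.Integer.Properties as ℤ
import Data.Integer.Tactic.RingSolver as ℤ-Solver
open import Data.Rational using (ℚ; mkℚ; 0ℚ; 1ℚ; ↥_; ↧_; ↧ₙ_; ≢-nonZero)
open import Data.Rational.Literals using (fromℤ)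
import Data.Rational.Properties as ℚ
import Data.Rational.Unnormalised as ℚᵘ
import Data.Rational.Unnormalised.Properties as ℚᵘ
open import Data.Fin as Fin using (Fin; zero; suc; funToFin; finToFun; fromℕ<; combine; _↑ˡ_; _↑ʳ_; splitAt; punchIn; punchOut)
open import Data.Fin.Patterns using (0F; 1F; 2F)
import Data.Fin.Properties as Fin
open import Data.List using (List; []; _∷_; _++_; map; filter; length; lookup; allFin; cartesianProductWith)
open import Data.List.Extrema ℤ.≤-totalOrder using (argmin; argmin-sel; f[argmin]≤f[⊤]; f[argmin]≤f[xs])
import Data.List.Membership.DecPropositional as DecMembership
open import Data.List.Membership.Propositional using (_∈_; lose)
open import Data.List.Membership.Propositional.Properties using (∈-++⁺ˡ; ∈-++⁺ʳ; ∈-map⁺; ∈-allFin; ∈-filter⁺; ∈-filter⁻; ∈-cartesianProductWith⁺)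
open import Data.List.Properties using (filter-notAll)
open import Data.List.Relation.Unary.All as All using (All; []; _∷_)
open import Data.List.Relation.Unary.Any using (here; there; index)
open import Data.List.Relation.Unary.Any.Properties using (lookup-index)
open import Data.Product using (Σ; _×_; _,_; proj₁; proj₂)
open import Data.Sum using (_⊎_; inj₁; inj₂; [_,_]′)
open import Data.Empty using (⊥; ⊥-elim)
open import Data.Unit using (⊤; tt)
open import Function using (_∘_)
open import Relation.Binary.PropositionalEquality
open import Relation.Nullary using (¬_; Dec; yes; no; ¬?)
open import Relation.Nullary.Decidable using (dec⇒maybe; decidable-stable; from-yes)
open import Tactic.RingSolver using (solve-∀)
open import Tactic.RingSolver.Core.AlmostCommutativeRing using (AlmostCommutativeRing; fromCommutativeRing)

module RationalMatrices where

  open import Data.Rational using (_+_; _*_; -_; _-_; _<_; 1/_)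

  -- Finite sums and cancellation in ℚ.

  ℚ-ring : AlmostCommutativeRing 0ℓ 0ℓ
  ℚ-ring = fromCommutativeRing ℚ.+-*-commutativeRing (λ x → dec⇒maybe (0ℚ ℚ.≟ x))

  sumFin-cong : ∀ n {f g : Fin n → ℚ} → (∀ i → f i ≡ g i) → sumFin n f ≡ sumFin n g
  sumFin-cong zero    eq = refl
  sumFin-cong (suc n) eq = cong₂ _+_ (eq zero) (sumFin-cong n (eq ∘ suc))

  sumFin-+ : ∀ n (f g : Fin n → ℚ) → sumFin n (λ i → f i + g i) ≡ sumFin n f + sumFin n g
  sumFin-+ zero    f g = refl
  sumFin-+ (suc n) f g = trans (cong (λ q → f zero + g zero + q) (sumFin-+ n (f ∘ suc) (g ∘ suc))) (interchange (f zero) (g zero) _ _)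
    where
    interchange : ∀ a b c d → (a + b) + (c + d) ≡ (a + c) + (b + d)
    interchange = solve-∀ ℚ-ring

  *-sumFin : ∀ n a (f : Fin n → ℚ) → sumFin n (λ i → a * f i) ≡ a * sumFin n f
  *-sumFin zero    a f = sym (ℚ.*-zeroʳ a)
  *-sumFin (suc n) a f = trans (cong (λ q → a * f zero + q) (*-sumFin n a (f ∘ suc))) (sym (ℚ.*-distribˡ-+ a (f zero) _))

  sumFin-* : ∀ n a (f : Fin n → ℚ) → sumFin n (λ i → f i * a) ≡ sumFin n f * a
  sumFin-* n a f = trans (sumFin-cong n (λ i → ℚ.*-comm (f i) a)) (trans (*-sumFin n a f) (ℚ.*-comm a _))

  sumFin-zero : ∀ n {f : Fin n → ℚ} → (∀ i → f i ≡ 0ℚ) → sumFin n f ≡ 0ℚ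
  sumFin-zero zero    eq = refl
  sumFin-zero (suc n) eq = cong₂ _+_ (eq zero) (sumFin-zero n (eq ∘ suc))

  sumFin-swap : ∀ m n (f : Fin m → Fin n → ℚ) →
    sumFin m (λ i → sumFin n (f i)) ≡ sumFin n (λ j → sumFin m (λ i → f i j))
  sumFin-swap zero    n f = sym (sumFin-zero n (λ _ → refl))
  sumFin-swap (suc m) n f = trans (cong (λ q → sumFin n (f zero) + q) (sumFin-swap m n (f ∘ suc))) (sym (sumFin-+ n _ _))

  δ : ∀ {n} → Fin n → Fin n → ℚ
  δ zero    zero    = 1ℚ
  δ zero    (suc _) = 0ℚ
  δ (suc _) zero    = 0ℚ
  δ (suc i) (suc j) = δ i j

  sumFin-δ : ∀ {n} (i : Fin n) (f : Fin n → ℚ) → sumFin n (λ j → δ i j * f j) ≡ f i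
  sumFin-δ {suc n} zero f = trans
    (cong₂ _+_ (ℚ.*-identityˡ (f zero)) (sumFin-zero n (λ j → ℚ.*-zeroˡ (f (suc j))))) (ℚ.+-identityʳ _)
  sumFin-δ {suc n} (suc i) f = trans
    (cong₂ _+_ (ℚ.*-zeroˡ (f zero)) (sumFin-δ i (f ∘ suc))) (ℚ.+-identityˡ _)

  *-nonzero : ∀ {x y} → x ≢ 0ℚ → y ≢ 0ℚ → x * y ≢ 0ℚ
  *-nonzero {x} {y} x≢0 y≢0 xy≡0 = y≢0 (begin
    y                ≡⟨ ℚ.*-identityˡ y ⟨
    1ℚ * y           ≡⟨ cong (_* y) (ℚ.*-inverseˡ x) ⟨
    (1/ x) * x * y   ≡⟨ ℚ.*-assoc (1/ x) x y ⟩
    (1/ x) * (x * y) ≡⟨ cong ((1/ x) *_) xy≡0 ⟩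
    (1/ x) * 0ℚ      ≡⟨ ℚ.*-zeroʳ (1/ x) ⟩
    0ℚ               ∎)
    where
    open ≡-Reasoning
    instance _ = ≢-nonZero x≢0

  *-cancelˡ-nonzero : ∀ {x y z} → z ≢ 0ℚ → z * x ≡ z * y → x ≡ y
  *-cancelˡ-nonzero {x} {y} {z} z≢0 eq = trans (sym (undo x)) (trans (cong ((1/ z) *_) eq) (undo y))
    where
    instance _ = ≢-nonZero z≢0
    undo : ∀ x → (1/ z) * (z * x) ≡ x
    undo x = trans (sym (ℚ.*-assoc (1/ z) z x)) (trans (cong (_* x) (ℚ.*-inverseˡ z)) (ℚ.*-identityˡ x))

  -- Van der Waerden's theorem by colour focusing, for arbitrary rational shifts.

  module _ {k : ℕ} where

    -- The list `L` is the finitary content: it is fixed before the colouring, so it can serve as a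
    -- block to be translated and as a set of shifts. The step is positive rather than merely
    -- nonzero because `focusing` adds steps.
    record MonoProgression {n} (F : Fin n → ℚ) (L : List ℚ) (χ : ℚ → Fin k) : Set where
      field
        base step  : ℚ
        colour     : Fin k
        step>0     : 0ℚ < step
        base∈      : base ∈ L
        step∈      : step ∈ L
        point∈     : ∀ i → base + F i * step ∈ L
        monochrome : ∀ i → χ (base + F i * step) ≡ colour

    record Spoke {n} (F : Fin n → ℚ) (L : List ℚ) (χ : ℚ → Fin k) (focus : ℚ) (colour : Fin k) : Set where
      field
        step       : ℚ
        step>0     : 0ℚ < step
        step∈      : step ∈ L
        point∈     : ∀ i → focus + F i * step ∈ L
        monochrome : ∀ i → χ (focus + F i * step) ≡ colour

    record Focused {n} (F : Fin n → ℚ) (L : List ℚ) (χ : ℚ → Fin k) (r : ℕ) : Set where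
      field
        focus    : ℚ
        focus∈   : focus ∈ L
        colours  : Fin r → Fin k
        distinct : ∀ {i j} → colours i ≡ colours j → i ≡ j
        spoke    : ∀ j → Spoke F L χ focus (colours j)

  with-zero : ∀ {n} → (Fin n → ℚ) → Fin (suc n) → ℚ
  with-zero F zero    = 0ℚ
  with-zero F (suc i) = F i

  VanDerWaerden : ∀ {n} → (Fin n → ℚ) → Set
  VanDerWaerden F = ∀ k → Σ (List ℚ) λ L → ∀ (χ : ℚ → Fin k) → MonoProgression F L χ

  -- The product colouring: the whole pattern of `χ` on the translate of `L` by `x`, coded as a
  -- single colour.
  block : ∀ {k} (L : List ℚ) → (ℚ → Fin k) → ℚ → Fin (k ℕ.^ length L)
  block L χ x = funToFin (λ i → χ (x + lookup L i))

  block-≡ : ∀ {k} (L : List ℚ) (χ : ℚ → Fin k) x x′ → block L χ x ≡ block L χ x′ →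
    ∀ {y} → y ∈ L → χ (x + y) ≡ χ (x′ + y)
  block-≡ L χ x x′ eq {y} y∈ = begin
    χ (x + y)                             ≡⟨ cong (λ t → χ (x + t)) (lookup-index y∈) ⟩
    χ (x + lookup L i)                    ≡⟨ Fin.finToFun-funToFin (λ i → χ (x + lookup L i)) i ⟨
    finToFun (block L χ x) i              ≡⟨ cong (λ t → finToFun t i) eq ⟩
    finToFun (block L χ x′) i             ≡⟨ Fin.finToFun-funToFin (λ i → χ (x′ + lookup L i)) i ⟩
    χ (x′ + lookup L i)                   ≡⟨ cong (λ t → χ (x′ + t)) (lookup-index y∈) ⟨
    χ (x′ + y)                            ∎
    where
    open ≡-Reasoning
    i = index y∈

  -- Colour focusing: repeating a translate of a focused configuration along a progression
  -- whose translates are coloured identically yields one more spoke.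
  focusing : ∀ {n} (F : Fin (suc n) → ℚ) → VanDerWaerden F → ∀ k r →
    Σ (List ℚ) λ L → ∀ (χ : ℚ → Fin k) → MonoProgression (with-zero F) L χ ⊎ Focused F L χ r
  focusing F vdw k zero = 0ℚ ∷ [] , λ χ → inj₂ record
    { focus = 0ℚ ; focus∈ = here refl ; colours = λ () ; distinct = λ { {()} } ; spoke = λ () }
  focusing {n} F vdw k (suc r) = L , go
    where
    Lᵣ = proj₁ (focusing F vdw k r)
    Lᶠ = proj₁ (vdw (k ℕ.^ length Lᵣ))
    L  = cartesianProductWith _+_ Lᶠ Lᵣ ++ (Lᶠ ++ Lᵣ)

    sum∈ : ∀ {x y z} → x ∈ Lᶠ → y ∈ Lᵣ → x + y ≡ z → z ∈ L
    sum∈ x∈ y∈ refl = ∈-++⁺ˡ (∈-cartesianProductWith⁺ _+_ x∈ y∈)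
    Lᶠ⊆ : ∀ {x} → x ∈ Lᶠ → x ∈ L
    Lᶠ⊆ x∈ = ∈-++⁺ʳ (cartesianProductWith _+_ Lᶠ Lᵣ) (∈-++⁺ˡ x∈)
    Lᵣ⊆ : ∀ {x} → x ∈ Lᵣ → x ∈ L
    Lᵣ⊆ x∈ = ∈-++⁺ʳ (cartesianProductWith _+_ Lᶠ Lᵣ) (∈-++⁺ʳ Lᶠ x∈)

    assoc-step : ∀ σ b f d → σ + (b + f * d) ≡ (σ + b) + f * d
    assoc-step = solve-∀ ℚ-ring
    zero-step : ∀ b d → b ≡ b + 0ℚ * d
    zero-step = solve-∀ ℚ-ring
    new-spoke : ∀ x b f e → (x + f * e) + b ≡ (x + b) + f * e
    new-spoke = solve-∀ ℚ-ring
    old-spoke : ∀ x b f e d → (x + f * e) + (b + f * d) ≡ (x + b) + f * (e + d)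
    old-spoke = solve-∀ ℚ-ring

    go : ∀ χ → MonoProgression (with-zero F) L χ ⊎ Focused F L χ (suc r)
    go χ = extend (proj₂ (focusing F vdw k r) (λ y → χ (σ + y)))
      where
      module P = MonoProgression (proj₂ (vdw (k ℕ.^ length Lᵣ)) (block Lᵣ χ))
      σ = P.base + F zero * P.step

      same : ∀ i {y} → y ∈ Lᵣ → χ ((P.base + F i * P.step) + y) ≡ χ (σ + y)
      same i = block-≡ Lᵣ χ (P.base + F i * P.step) σ (trans (P.monochrome i) (sym (P.monochrome zero)))

      extend : MonoProgression (with-zero F) Lᵣ (λ y → χ (σ + y)) ⊎ Focused F Lᵣ (λ y → χ (σ + y)) r →
        MonoProgression (with-zero F) L χ ⊎ Focused F L χ (suc r)
      extend (inj₁ G) = inj₁ record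
        { base       = σ + G.base
        ; step       = G.step
        ; colour     = G.colour
        ; step>0     = G.step>0
        ; base∈      = sum∈ (P.point∈ zero) G.base∈ refl
        ; step∈      = Lᵣ⊆ G.step∈
        ; point∈     = λ i → sum∈ (P.point∈ zero) (G.point∈ i) (assoc-step σ G.base (with-zero F i) G.step)
        ; monochrome = λ i → trans (cong χ (sym (assoc-step σ G.base (with-zero F i) G.step))) (G.monochrome i)
        }
        where module G = MonoProgression G
      extend (inj₂ G) with Fin.any? (λ j → Focused.colours G j Fin.≟ χ (σ + Focused.focus G))
      ... | yes (j , cⱼ≡) = inj₁ record
        { base       = σ + G.focus
        ; step       = T.step
        ; colour     = G.colours j
        ; step>0     = T.step>0
        ; base∈      = sum∈ (P.point∈ zero) G.focus∈ refl
        ; step∈      = Lᵣ⊆ T.step∈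
        ; point∈     = λ { zero    → sum∈ (P.point∈ zero) G.focus∈ (zero-step (σ + G.focus) T.step)
                         ; (suc i) → sum∈ (P.point∈ zero) (T.point∈ i) (assoc-step σ G.focus (F i) T.step) }
        ; monochrome = λ { zero    → trans (cong χ (sym (zero-step (σ + G.focus) T.step))) (sym cⱼ≡)
                         ; (suc i) → trans (cong χ (sym (assoc-step σ G.focus (F i) T.step))) (T.monochrome i) }
        }
        where
        module G = Focused G
        module T = Spoke (G.spoke j)
      -- The copies of the configuration at `P.base + F i * P.step` are all coloured like the one at
      -- `σ`, and the new focus belongs to the translate with shift 0. The copies of the old focus
      -- form the new spoke; the old spokes continue diagonally, with the two steps added.
      ... | no new = inj₂ record
        { focus    = P.base + G.focus
        ; focus∈   = sum∈ P.base∈ G.focus∈ refl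
        ; colours  = λ { zero → χ (σ + G.focus) ; (suc j) → G.colours j }
        ; distinct = λ { {zero}  {zero}  _  → refl
                       ; {zero}  {suc j} eq → ⊥-elim (new (j , sym eq))
                       ; {suc i} {zero}  eq → ⊥-elim (new (i , eq))
                       ; {suc i} {suc j} eq → cong suc (G.distinct eq) }
        ; spoke    = λ
          { zero → record
            { step       = P.step
            ; step>0     = P.step>0
            ; step∈      = Lᶠ⊆ P.step∈
            ; point∈     = λ i → sum∈ (P.point∈ i) G.focus∈ (new-spoke P.base G.focus (F i) P.step)
            ; monochrome = λ i → trans (cong χ (sym (new-spoke P.base G.focus (F i) P.step))) (same i G.focus∈)
            }
          ; (suc j) → let module T = Spoke (G.spoke j) in record
            { step       = P.step + T.step
            ; step>0     = ℚ.+-mono-< P.step>0 T.step>0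
            ; step∈      = sum∈ P.step∈ T.step∈ refl
            ; point∈     = λ i → sum∈ (P.point∈ i) (T.point∈ i) (old-spoke P.base G.focus (F i) P.step T.step)
            ; monochrome = λ i → trans (cong χ (sym (old-spoke P.base G.focus (F i) P.step T.step)))
                                   (trans (same i (T.point∈ i)) (T.monochrome i))
            }
          }
        }
        where module G = Focused G

  -- Asking for one spoke more than there are colours rules out the focused alternative, since the
  -- spokes have distinct colours.
  vanDerWaerden-with-zero : ∀ {n} (F : Fin (suc n) → ℚ) → VanDerWaerden F → VanDerWaerden (with-zero F)
  vanDerWaerden-with-zero F vdw k = proj₁ (focusing F vdw k (suc k)) , λ χ → mono (proj₂ (focusing F vdw k (suc k)) χ)
    where
    mono : ∀ {L χ} → MonoProgression (with-zero F) L χ ⊎ Focused F L χ (suc k) → MonoProgression (with-zero F) L χ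
    mono (inj₁ P) = P
    mono (inj₂ G) with Fin.pigeonhole (ℕ.n<1+n k) (Focused.colours G)
    ... | i , j , i<j , eq = ⊥-elim (Fin.<⇒≢ i<j (Focused.distinct G eq))

  0<1 : 0ℚ < 1ℚ
  0<1 = from-yes (0ℚ ℚ.<? 1ℚ)

  -- Induction on the number of shifts. Subtracting the first shift `f` from all of them turns it
  -- into the added zero of `with-zero`; moving the base by `f * step` undoes the subtraction.
  vanDerWaerden : ∀ n (F : Fin (suc n) → ℚ) → VanDerWaerden F
  vanDerWaerden zero F k = 0ℚ ∷ 1ℚ ∷ (0ℚ + F zero * 1ℚ) ∷ [] , λ χ → record
    { base = 0ℚ ; step = 1ℚ ; colour = χ (0ℚ + F zero * 1ℚ) ; step>0 = 0<1
    ; base∈ = here refl ; step∈ = there (here refl)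
    ; point∈ = λ { zero → there (there (here refl)) }
    ; monochrome = λ { zero → refl } }
  vanDerWaerden (suc n) F k = cartesianProductWith _-ᶠ_ L₀ L₀ ++ L₀ , go
    where
    f = F zero
    F₀ : Fin (suc n) → ℚ
    F₀ i = F (suc i) - f
    vdw₀ = vanDerWaerden-with-zero F₀ (vanDerWaerden n F₀) k
    L₀ = proj₁ vdw₀
    _-ᶠ_ : ℚ → ℚ → ℚ
    b -ᶠ d = b - f * d
    first : ∀ f b d → (b - f * d) + f * d ≡ b + 0ℚ * d
    first = solve-∀ ℚ-ring
    later : ∀ f b d g → (b - f * d) + g * d ≡ b + (g - f) * d
    later = solve-∀ ℚ-ring
    shift : ∀ i b d → (b -ᶠ d) + F i * d ≡ b + with-zero F₀ i * d
    shift zero    b d = first f b d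
    shift (suc i) b d = later f b d (F (suc i))

    go : ∀ χ → MonoProgression F (cartesianProductWith _-ᶠ_ L₀ L₀ ++ L₀) χ
    go χ = record
      { base       = P.base -ᶠ P.step
      ; step       = P.step
      ; colour     = P.colour
      ; step>0     = P.step>0
      ; base∈      = ∈-++⁺ˡ (∈-cartesianProductWith⁺ _-ᶠ_ P.base∈ P.step∈)
      ; step∈      = L₀⊆ P.step∈
      ; point∈     = λ i → subst (_∈ _) (sym (shift i P.base P.step)) (L₀⊆ (P.point∈ i))
      ; monochrome = λ i → trans (cong χ (shift i P.base P.step)) (P.monochrome i)
      }
      where
      module P = MonoProgression (proj₂ vdw₀ χ)
      L₀⊆ : ∀ {x} → x ∈ L₀ → x ∈ cartesianProductWith _-ᶠ_ L₀ L₀ ++ L₀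
      L₀⊆ = ∈-++⁺ʳ (cartesianProductWith _-ᶠ_ L₀ L₀)

  record NonzeroProgression {k} (F L : List ℚ) (χ : ℚ → Fin k) : Set where
    field
      base step  : ℚ
      colour     : Fin k
      base≢0     : base ≢ 0ℚ
      step≢0     : step ≢ 0ℚ
      base∈      : base ∈ L
      step∈      : step ∈ L
      monochrome : ∀ {g} → g ∈ F → χ (base + g * step) ≡ colour

  -- The base is to become a generator, so it must not vanish. If it does, it is replaced by base
  -- plus step, and for this the progression was taken with the shifts `1 + g` as well. The shift
  -- `1ℚ` puts the replacement into the list.
  vanDerWaerden-nonzero : ∀ k (F : List ℚ) → Σ (List ℚ) λ L → ∀ (χ : ℚ → Fin k) → NonzeroProgression F L χ
  vanDerWaerden-nonzero k F = proj₁ vdw , go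
    where
    G = 1ℚ ∷ F ++ map (λ g → 1ℚ + g) F
    vdw = vanDerWaerden _ (lookup G) k

    one-step : ∀ b d → b + 1ℚ * d ≡ b + d
    one-step = solve-∀ ℚ-ring
    next-step : ∀ b g d → (b + d) + g * d ≡ b + (1ℚ + g) * d
    next-step = solve-∀ ℚ-ring

    go : ∀ χ → NonzeroProgression F (proj₁ vdw) χ
    go χ with MonoProgression.base (proj₂ vdw χ) ℚ.≟ 0ℚ
    ... | no b≢0 = record
      { base = P.base ; step = P.step ; colour = P.colour
      ; base≢0 = b≢0 ; step≢0 = ℚ.<⇒≢ P.step>0 ∘ sym ; base∈ = P.base∈ ; step∈ = P.step∈
      ; monochrome = λ g∈ → mono (there (∈-++⁺ˡ g∈)) }
      where
      module P = MonoProgression (proj₂ vdw χ)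
      mono : ∀ {g} → g ∈ G → χ (P.base + g * P.step) ≡ P.colour
      mono g∈ = trans (cong (λ g → χ (P.base + g * P.step)) (lookup-index g∈)) (P.monochrome (index g∈))
    ... | yes b≡0 = record
      { base = P.base + P.step ; step = P.step ; colour = P.colour
      ; base≢0 = λ eq → step≢0 (trans (sym (ℚ.+-identityˡ P.step)) (trans (cong (_+ P.step) (sym b≡0)) eq))
      ; step≢0 = step≢0
      ; base∈ = subst (_∈ proj₁ vdw) (one-step P.base P.step) (P.point∈ zero)
      ; step∈ = P.step∈
      ; monochrome = λ {g} g∈ → trans (cong χ (next-step P.base g P.step))
                                      (mono (there (∈-++⁺ʳ F (∈-map⁺ (λ g → 1ℚ + g) g∈)))) }
      where
      module P = MonoProgression (proj₂ vdw χ)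
      step≢0 : P.step ≢ 0ℚ
      step≢0 = ℚ.<⇒≢ P.step>0 ∘ sym
      mono : ∀ {g} → g ∈ G → χ (P.base + g * P.step) ≡ P.colour
      mono g∈ = trans (cong (λ g → χ (P.base + g * P.step)) (lookup-index g∈)) (P.monochrome (index g∈))

  -- Deuber's sets of combinations with first nonzero coefficient one.

  FirstEntryOne : ∀ {n} → QVec n → Set
  FirstEntryOne {zero}  r = ⊥
  FirstEntryOne {suc n} r = r zero ≡ 1ℚ ⊎ (r zero ≡ 0ℚ × FirstEntryOne (r ∘ suc))

  dot : ∀ {n} → QVec n → QVec n → ℚ
  dot {n} r a = sumFin n (λ t → r t * a t)

  dot-scale : ∀ {n} (r a : QVec n) d → dot r (λ t → d * a t) ≡ d * dot r a
  dot-scale {n} r a d = trans (sumFin-cong n (λ t → left-comm (r t) d (a t))) (*-sumFin n d _)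
    where
    left-comm : ∀ x y z → x * (y * z) ≡ y * (x * z)
    left-comm = solve-∀ ℚ-ring

  -- A variant of Deuber's (m,p,c)-sets with leading coefficient 1 and the other coefficients in
  -- `Λ`. The field `comb∈` covers all coefficient vectors, since arbitrary combinations occur as
  -- shifts once a further generator is put in front.
  record DeuberSet (Λ : List ℚ) {k} (χ : ℚ → Fin k) (L : List ℚ) (c : Fin k) (m : ℕ) : Set where
    field
      gen        : QVec m
      gen≢0      : ∀ t → gen t ≢ 0ℚ
      comb∈      : ∀ r → (∀ t → r t ∈ Λ) → dot r gen ∈ L
      monochrome : ∀ r → (∀ t → r t ∈ Λ) → FirstEntryOne r → χ (dot r gen) ≡ c

  sumℕ : ∀ {k} → (Fin k → ℕ) → ℕ
  sumℕ {zero}  g = 0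
  sumℕ {suc k} g = g zero ℕ.+ sumℕ (g ∘ suc)

  sumℕ-zero : ∀ k → sumℕ {k} (λ _ → 0) ≡ 0
  sumℕ-zero zero    = refl
  sumℕ-zero (suc k) = sumℕ-zero k

  sumℕ-pigeonhole : ∀ {k} (g : Fin k → ℕ) n → k ℕ.* n ℕ.< sumℕ g → Σ (Fin k) λ c → n ℕ.< g c
  sumℕ-pigeonhole {suc k} g n lt with n ℕ.<? g zero
  ... | yes n<g = zero , n<g
  ... | no  n≮g with sumℕ-pigeonhole (g ∘ suc) n
                       (ℕ.≰⇒> (λ le → ℕ.<⇒≱ lt (ℕ.+-mono-≤ (ℕ.≮⇒≥ n≮g) le)))
  ...   | c , n<g = suc c , n<g

  increment : ∀ {k} → Fin k → (Fin k → ℕ) → Fin k → ℕ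
  increment zero    g zero    = suc (g zero)
  increment zero    g (suc j) = g (suc j)
  increment (suc c) g zero    = g zero
  increment (suc c) g (suc j) = increment c (g ∘ suc) j

  sumℕ-increment : ∀ {k} (c : Fin k) g → sumℕ (increment c g) ≡ suc (sumℕ g)
  sumℕ-increment zero    g = refl
  sumℕ-increment (suc c) g = trans (cong (g zero ℕ.+_) (sumℕ-increment c (g ∘ suc))) (ℕ.+-suc (g zero) _)

  increment-elim : ∀ {k} (P : Fin k → ℕ → Set) (c : Fin k) g →
    P c (suc (g c)) → (∀ j → P j (g j)) → ∀ j → P j (increment c g j)
  increment-elim P zero    g p ps zero    = p
  increment-elim P zero    g p ps (suc j) = ps (suc j)
  increment-elim P (suc c) g p ps zero    = ps zero
  increment-elim P (suc c) g p ps (suc j) = increment-elim (P ∘ suc) c (g ∘ suc) p (ps ∘ suc) j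

  -- Each application of van der Waerden's theorem prepends a generator to the Deuber set of one of the colours,
  -- after rescaling everything built before by the step of the progression.
  deuber-levels : ∀ (Λ : List ℚ) k M → Σ (List ℚ) λ L → ∀ (χ : ℚ → Fin k) →
    Σ (Fin k → ℕ) λ g → sumℕ g ≡ M × (∀ c → DeuberSet Λ χ L c (g c))
  deuber-levels Λ k zero = 0ℚ ∷ [] , λ χ → (λ _ → 0) , sumℕ-zero k , λ c → record
    { gen = λ () ; gen≢0 = λ () ; comb∈ = λ _ _ → here refl ; monochrome = λ _ _ () }
  deuber-levels Λ k (suc M) = L , go
    where
    L₀ = proj₁ (deuber-levels Λ k M)
    Lᵛ = proj₁ (vanDerWaerden-nonzero k L₀)
    scaled  = cartesianProductWith _*_ Lᵛ L₀
    leading = cartesianProductWith _*_ Λ Lᵛ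
    L = cartesianProductWith _+_ leading scaled ++ scaled

    go : ∀ χ → Σ (Fin k → ℕ) λ g → sumℕ g ≡ suc M × (∀ c → DeuberSet Λ χ L c (g c))
    -- As `L₀` is independent of the colouring, a progression with shifts `L₀` can be chosen first.
    -- The induction hypothesis then goes to the colouring dilated by its step, so that base plus
    -- step times any earlier combination has the progression's colour.
    go χ with proj₂ (deuber-levels Λ k M) (λ q → χ (NonzeroProgression.step (proj₂ (vanDerWaerden-nonzero k L₀) χ) * q))
    ... | g , sum≡ , sets = increment P.colour g , trans (sumℕ-increment P.colour g) (cong suc sum≡) ,
            increment-elim (DeuberSet Λ χ L) P.colour g extended rescaled
      where
      module P = NonzeroProgression (proj₂ (vanDerWaerden-nonzero k L₀) χ)

      rescaled≢0 : ∀ {q} → q ≢ 0ℚ → P.step * q ≢ 0ℚ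
      rescaled≢0 = *-nonzero P.step≢0

      rescaled : ∀ c → DeuberSet Λ χ L c (g c)
      rescaled c = record
        { gen        = λ t → P.step * D.gen t
        ; gen≢0      = λ t → rescaled≢0 (D.gen≢0 t)
        ; comb∈      = λ r r∈ → subst (_∈ L) (sym (dot-scale r D.gen P.step))
            (∈-++⁺ʳ (cartesianProductWith _+_ leading scaled) (∈-cartesianProductWith⁺ _*_ P.step∈ (D.comb∈ r r∈)))
        ; monochrome = λ r r∈ fe → trans (cong χ (dot-scale r D.gen P.step)) (D.monochrome r r∈ fe)
        }
        where module D = DeuberSet (sets c)

      extended : DeuberSet Λ χ L P.colour (suc (g P.colour))
      extended = record
        { gen        = gen
        ; gen≢0      = λ { zero → P.base≢0 ; (suc t) → rescaled≢0 (D.gen≢0 t) }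
        ; comb∈      = λ r r∈ → ∈-++⁺ˡ (∈-cartesianProductWith⁺ _+_ (∈-cartesianProductWith⁺ _*_ (r∈ zero) P.base∈)
            (subst (_∈ scaled) (sym (dot-scale (r ∘ suc) D.gen P.step))
              (∈-cartesianProductWith⁺ _*_ P.step∈ (D.comb∈ (r ∘ suc) (r∈ ∘ suc)))))
        ; monochrome = mono
        }
        where
        module D = DeuberSet (sets P.colour)
        gen : QVec (suc (g P.colour))
        gen zero    = P.base
        gen (suc t) = P.step * D.gen t

        lead-one : ∀ b y d → 1ℚ * b + d * y ≡ b + y * d
        lead-one = solve-∀ ℚ-ring
        lead-zero : ∀ b y → 0ℚ * b + y ≡ y
        lead-zero = solve-∀ ℚ-ring

        mono : ∀ r → (∀ t → r t ∈ Λ) → FirstEntryOne r → χ (dot r gen) ≡ P.colour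
        mono r r∈ (inj₁ r₀≡1) = trans
          (cong χ (trans (cong₂ (λ x y → x * P.base + y) r₀≡1 (dot-scale (r ∘ suc) D.gen P.step))
                         (lead-one P.base (dot (r ∘ suc) D.gen) P.step)))
          (P.monochrome (D.comb∈ (r ∘ suc) (r∈ ∘ suc)))
        mono r r∈ (inj₂ (r₀≡0 , fe)) = trans
          (cong χ (trans (cong₂ (λ x y → x * P.base + y) r₀≡0 (dot-scale (r ∘ suc) D.gen P.step))
                         (lead-zero P.base (P.step * dot (r ∘ suc) D.gen))))
          (D.monochrome (r ∘ suc) (r∈ ∘ suc) fe)

  -- Padding with a leading coefficient 0 preserves the first-entry condition, so the first
  -- generator can be forgotten.
  deuber-drop : ∀ {Λ k} {χ : ℚ → Fin k} {L c m} → 0ℚ ∈ Λ → DeuberSet Λ χ L c (suc m) → DeuberSet Λ χ L c m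
  deuber-drop {Λ} {χ = χ} {L} {m = m} 0∈ D = record
    { gen        = D.gen ∘ suc
    ; gen≢0      = D.gen≢0 ∘ suc
    ; comb∈      = λ r r∈ → subst (_∈ L) (drop r) (D.comb∈ (pad r) (pad∈ r r∈))
    ; monochrome = λ r r∈ fe → trans (cong χ (sym (drop r))) (D.monochrome (pad r) (pad∈ r r∈) (inj₂ (refl , fe)))
    }
    where
    module D = DeuberSet D
    pad : QVec m → QVec (suc m)
    pad r zero    = 0ℚ
    pad r (suc t) = r t
    pad∈ : ∀ r → (∀ t → r t ∈ Λ) → ∀ t → pad r t ∈ Λ
    pad∈ r r∈ zero    = 0∈
    pad∈ r r∈ (suc t) = r∈ t
    lead-zero : ∀ b y → 0ℚ * b + y ≡ y
    lead-zero = solve-∀ ℚ-ring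
    drop : ∀ r → dot (pad r) D.gen ≡ dot r (D.gen ∘ suc)
    drop r = lead-zero (D.gen zero) (dot r (D.gen ∘ suc))

  deuber-shrink : ∀ {Λ k} {χ : ℚ → Fin k} {L c m n} → 0ℚ ∈ Λ → n ℕ.≤′ m → DeuberSet Λ χ L c m → DeuberSet Λ χ L c n
  deuber-shrink 0∈ (ℕ.≤′-reflexive refl) D = D
  deuber-shrink 0∈ (ℕ.≤′-step n≤m)       D = deuber-shrink 0∈ n≤m (deuber-drop 0∈ D)

  deuber : ∀ (Λ : List ℚ) → 0ℚ ∈ Λ → ∀ k n → Σ (List ℚ) λ L → ∀ (χ : ℚ → Fin k) →
    Σ (Fin k) λ c → DeuberSet Λ χ L c (suc n)
  deuber Λ 0∈ k n = proj₁ levels , go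
    where
    -- With `k * n + 1` generators shared among `k` colours, some colour receives more than `n`.
    levels = deuber-levels Λ k (suc (k ℕ.* n))
    go : ∀ χ → Σ (Fin k) λ c → DeuberSet Λ χ (proj₁ levels) c (suc n)
    go χ with proj₂ levels χ
    ... | g , sum≡ , sets with sumℕ-pigeonhole g n (ℕ.≤-reflexive (sym sum≡))
    ...   | c , n<g = c , deuber-shrink 0∈ (ℕ.≤⇒≤′ n<g) (sets c)

  -- Integers inside ℚ and common denominators.

  fromℤ-+ : ∀ m n → fromℤ (m ℤ.+ n) ≡ fromℤ m + fromℤ n
  fromℤ-+ m n = ℚ.toℚᵘ-injective (ℚᵘ.≃-trans (ℚᵘ.*≡* (lemma m n)) (ℚᵘ.≃-sym (ℚ.toℚᵘ-homo-+ (fromℤ m) (fromℤ n))))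
    where
    lemma : ∀ m n → (m ℤ.+ n) ℤ.* (+ 1) ≡ (m ℤ.* + 1 ℤ.+ n ℤ.* + 1) ℤ.* + 1
    lemma = ℤ-Solver.solve-∀

  fromℤ-* : ∀ m n → fromℤ (m ℤ.* n) ≡ fromℤ m * fromℤ n
  fromℤ-* m n = ℚ.toℚᵘ-injective (ℚᵘ.≃-sym (ℚ.toℚᵘ-homo-* (fromℤ m) (fromℤ n)))

  fromℤ-neg : ∀ n → fromℤ (ℤ.- n) ≡ - fromℤ n
  fromℤ-neg (+ zero)  = refl
  fromℤ-neg (+ suc n) = refl
  fromℤ-neg -[1+ n ]  = refl

  fromℤ-↥ : ∀ q → fromℤ (↥ q) ≡ fromℤ (↧ q) * q
  fromℤ-↥ q@(mkℚ n d c) = ℚ.toℚᵘ-injective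
    (ℚᵘ.≃-trans (ℚᵘ.*≡* (trans (cong (n ℤ.*_) (cong +_ (cong suc (ℕ.+-identityʳ d)))) (lemma n (+ suc d)))) (ℚᵘ.≃-sym (ℚ.toℚᵘ-homo-* (fromℤ (↧ q)) q)))
    where
    lemma : ∀ n d → n ℤ.* d ≡ (d ℤ.* n) ℤ.* (+ 1)
    lemma = ℤ-Solver.solve-∀

  IsInteger : ℚ → Set
  IsInteger q = Σ ℤ λ n → q ≡ fromℤ n

  isInteger? : ∀ q → Dec (IsInteger q)
  isInteger? (mkℚ n zero    _) = yes (n , refl)
  isInteger? (mkℚ n (suc d) _) = no λ { (m , ()) }

  fromℤ-nonzero : ∀ {n} → n ≢ + 0 → fromℤ n ≢ 0ℚ
  fromℤ-nonzero n≢0 eq = n≢0 (cong ↥_ eq)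

  integer-* : ∀ {x y} → IsInteger x → IsInteger y → IsInteger (x * y)
  integer-* (m , refl) (n , refl) = m ℤ.* n , sym (fromℤ-* m n)

  record CommonDenominator (L : List ℚ) : Set where
    field
      den     : ℚ
      integer : IsInteger den
      den≢0   : den ≢ 0ℚ
      clears  : ∀ {q} → q ∈ L → IsInteger (den * q)

  commonDenominator : ∀ L → CommonDenominator L
  commonDenominator []      = record
    { den = 1ℚ ; integer = + 1 , refl ; den≢0 = λ () ; clears = λ () }
  commonDenominator (q ∷ L) = record
    { den     = C.den * fromℤ (↧ q)
    ; integer = integer-* C.integer (↧ q , refl)
    ; den≢0   = *-nonzero C.den≢0 (fromℤ-nonzero {↧ q} λ ())
    ; clears  = λ
      { (here refl) → subst IsInteger (trans (cong (C.den *_) (fromℤ-↥ q)) (sym (ℚ.*-assoc C.den (fromℤ (↧ q)) q)))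
                        (integer-* C.integer (↥ q , refl))
      ; (there x∈) → subst IsInteger (swap C.den _ (fromℤ (↧ q))) (integer-* (C.clears x∈) (↧ q , refl)) }
    }
    where
    module C = CommonDenominator (commonDenominator L)
    swap : ∀ a x b → (a * x) * b ≡ (a * b) * x
    swap = solve-∀ ℚ-ring

  -- Image partition regularity over a nontrivial subgroup.

  module Subgroup {S : ℚ → Set} (sub : IsSubgroup S) where
    open IsSubgroup sub

    ℕ-multiple : ∀ n {x} → S x → S (fromℤ (+ n) * x)
    ℕ-multiple zero    {x} x∈ = subst S (sym (ℚ.*-zeroˡ x)) zero∈
    ℕ-multiple (suc n) {x} x∈ = subst S (trans (lemma (fromℤ (+ n)) x) (cong (_* x) (sym (fromℤ-+ (+ 1) (+ n)))))
      (+-closed x∈ (ℕ-multiple n x∈))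
      where
      lemma : ∀ m x → x + m * x ≡ (1ℚ + m) * x
      lemma = solve-∀ ℚ-ring

    integer-multiple : ∀ {m x} → IsInteger m → S x → S (m * x)
    integer-multiple {x = x} (+ n     , refl) x∈ = ℕ-multiple n x∈
    integer-multiple {x = x} (-[1+ n ] , refl) x∈ =
      subst S (ℚ.neg-distribˡ-* (fromℤ (+ suc n)) x) (neg-closed (ℕ-multiple (suc n) x∈))

    sumFin-closed : ∀ n {f : Fin n → ℚ} → (∀ i → S (f i)) → S (sumFin n f)
    sumFin-closed zero    f∈ = zero∈
    sumFin-closed (suc n) f∈ = +-closed (f∈ zero) (sumFin-closed n (f∈ ∘ suc))

    -- Multiplication by `κ`, a common denominator of the Deuber list times a nonzero `s` in `S`,
    -- maps that list into ℤ s, hence into `S`. The colouring of `S` is pulled back along it to ℚ,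
    -- and the resulting generators are scaled by `κ`.
    firstEntries-IPR : Nontrivial S → ∀ {w n} (E : Matrix w (suc n)) → (∀ i → FirstEntryOne (E i)) →
      ∀ k (c : Colouring S k) → Σ (QVec (suc n)) λ x → MonoIn S c (E · x)
    firstEntries-IPR (s , s∈ , s≢0) {w} {n} E fe k c = (λ t → κ * D.gen t) , solution (D-colour refl)
      where
      Λ = 0ℚ ∷ 1ℚ ∷ cartesianProductWith E (allFin w) (allFin (suc n))
      E∈ : ∀ i t → E i t ∈ Λ
      E∈ i t = there (there (∈-cartesianProductWith⁺ E (∈-allFin i) (∈-allFin t)))

      L = proj₁ (deuber Λ (here refl) (suc k) n)
      module C = CommonDenominator (commonDenominator L)
      κ = C.den * s

      rearrange : ∀ d q s → (d * q) * s ≡ (d * s) * q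
      rearrange = solve-∀ ℚ-ring

      κ-mem : ∀ q → IsInteger (C.den * q) → S (κ * q)
      κ-mem q int = subst S (rearrange C.den q s) (integer-multiple int s∈)

      -- Colour zero is reserved for the rationals q with κ q outside ℤ s ∖ {0}.
      χ : ℚ → Fin (suc k)
      χ q with isInteger? (C.den * q) | (κ * q) ℚ.≟ 0ℚ
      ... | yes int | no κq≢0 = suc (c (κ * q , κ-mem q int , κq≢0))
      ... | yes int | yes _   = zero
      ... | no _    | _       = zero

      -- A colouring may depend on the proofs of membership and nonvanishing, so the very proofs
      -- used in `χ` are returned. Membership in `S` need not be decidable; `χ` tests integrality of
      -- `C.den * q` instead.
      χ-suc : ∀ q {col} → χ q ≡ suc col →
        Σ (S (κ * q)) λ p → Σ (κ * q ≢ 0ℚ) λ q≢0 → c (κ * q , p , q≢0) ≡ col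
      χ-suc q eq with isInteger? (C.den * q) | (κ * q) ℚ.≟ 0ℚ
      χ-suc q eq | yes int | no κq≢0 = κ-mem q int , κq≢0 , Fin.suc-injective eq
      χ-suc q () | yes int | yes _
      χ-suc q () | no _    | _

      χ≢zero : ∀ q → q ∈ L → q ≢ 0ℚ → χ q ≢ zero
      χ≢zero q q∈ q≢0 eq with isInteger? (C.den * q) | (κ * q) ℚ.≟ 0ℚ
      χ≢zero q q∈ q≢0 () | yes int | no _
      χ≢zero q q∈ q≢0 eq | yes int | yes κq≡0 = *-nonzero (*-nonzero C.den≢0 s≢0) q≢0 κq≡0
      χ≢zero q q∈ q≢0 eq | no ¬int | _        = ¬int (C.clears q∈)

      found = proj₂ (deuber Λ (here refl) (suc k) n) χ
      module D = DeuberSet (proj₂ found)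

      -- The first generator is the combination with coefficients `δ zero`, so it carries the common
      -- colour; being a nonzero member of `L`, it avoids the reserved colour.
      D-colour : ∀ {col} → proj₁ found ≡ col → Σ (Fin k) λ col′ → proj₁ found ≡ suc col′
      D-colour {suc col} eq = col , eq
      D-colour {zero}    eq = ⊥-elim (χ≢zero (D.gen zero)
          (subst (_∈ L) (sumFin-δ zero D.gen) (D.comb∈ (δ zero) δ∈)) (D.gen≢0 zero)
          (trans (cong χ (sym (sumFin-δ zero D.gen))) (trans (D.monochrome (δ zero) δ∈ (inj₁ refl)) eq)))
        where
        δ∈ : ∀ (t : Fin (suc n)) → δ zero t ∈ Λ
        δ∈ zero    = there (here refl)
        δ∈ (suc t) = here refl

      solution : (Σ (Fin k) λ col → proj₁ found ≡ suc col) → MonoIn S c (E · (λ t → κ * D.gen t))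
      solution (col , eq) = col , λ i → subst (λ z → Σ (S z) λ p → Σ (z ≢ 0ℚ) λ q → c (z , p , q) ≡ col)
        (sym (dot-scale (E i) D.gen κ))
        (χ-suc (dot (E i) D.gen) (trans (D.monochrome (E i) (E∈ i) (fe i)) eq))

  -- The Fredholm alternative over ℚ.

  dot-comm : ∀ {n} (f g : QVec n) → dot f g ≡ dot g f
  dot-comm {n} f g = sumFin-cong n (λ i → ℚ.*-comm (f i) (g i))

  dot-linear : ∀ {n} (r f g : QVec n) β → dot r (λ i → f i - β * g i) ≡ dot r f - β * dot r g
  dot-linear {n} r f g β = begin
    sumFin n (λ i → r i * (f i - β * g i))               ≡⟨ sumFin-cong n (λ i → expand (r i) (f i) β (g i)) ⟩
    sumFin n (λ i → r i * f i + (- β) * (r i * g i))     ≡⟨ sumFin-+ n _ _ ⟩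
    dot r f + sumFin n (λ i → (- β) * (r i * g i))       ≡⟨ cong (λ q → dot r f + q) (*-sumFin n (- β) _) ⟩
    dot r f + (- β) * dot r g                            ≡⟨ cong (λ q → dot r f + q) (ℚ.neg-distribˡ-* β (dot r g)) ⟨
    dot r f - β * dot r g                                ∎
    where
    open ≡-Reasoning
    expand : ∀ r f β g → r * (f - β * g) ≡ r * f + (- β) * (r * g)
    expand = solve-∀ ℚ-ring

  Solvable : ∀ {m n} → Matrix m n → QVec m → Set
  Solvable {n = n} M b = Σ (QVec n) λ y → ∀ i → (M · y) i ≡ b i

  Obstructed : ∀ {m n} → Matrix m n → QVec m → Set
  Obstructed {m} M b = Σ (QVec m) λ w → (∀ j → dot w (λ i → M i j) ≡ 0ℚ) × dot w b ≡ 1ℚ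

  -- Induction on the columns: the first variable is set to 0 if the remaining columns suffice.
  -- Otherwise their obstruction `w` either kills the first column too, or determines the first
  -- variable.
  fredholm : ∀ {m} n (M : Matrix m n) (b : QVec m) → Solvable M b ⊎ Obstructed M b
  fredholm {m} zero M b with Fin.any? (λ i → ¬? (b i ℚ.≟ 0ℚ))
  ... | no b≡0 = inj₁ ((λ ()) , λ i → sym (decidable-stable (b i ℚ.≟ 0ℚ) (λ bᵢ≢0 → b≡0 (i , bᵢ≢0))))
  ... | yes (i , bᵢ≢0) = inj₂ ((λ k → (1/ b i) * δ i k) , (λ ()) , (begin
    sumFin m (λ k → (1/ b i) * δ i k * b k)    ≡⟨ sumFin-cong m (λ k → ℚ.*-assoc (1/ b i) (δ i k) (b k)) ⟩
    sumFin m (λ k → (1/ b i) * (δ i k * b k))  ≡⟨ *-sumFin m (1/ b i) _ ⟩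
    (1/ b i) * sumFin m (λ k → δ i k * b k)    ≡⟨ cong ((1/ b i) *_) (sumFin-δ i b) ⟩
    (1/ b i) * b i                             ≡⟨ ℚ.*-inverseˡ (b i) ⟩
    1ℚ                                         ∎))
    where
    open ≡-Reasoning
    instance _ = ≢-nonZero bᵢ≢0
  fredholm {m} (suc n) M b with fredholm n (λ i j → M i (suc j)) b
  ... | inj₁ (y , My≡b) = inj₁ ((λ { zero → 0ℚ ; (suc j) → y j }) ,
          λ i → trans (cong₂ _+_ (ℚ.*-zeroʳ (M i zero)) (My≡b i)) (ℚ.+-identityˡ (b i)))
  ... | inj₂ (w , w⊥ , wb≡1) with dot w (λ i → M i zero) ℚ.≟ 0ℚ
  ...   | yes w⊥₀ = inj₂ (w , (λ { zero → w⊥₀ ; (suc j) → w⊥ j }) , wb≡1)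
  ...   | no α≢0 = eliminate (fredholm n (λ i j → M i (suc j)) (λ i → b i - β * M i zero))
    where
    open ≡-Reasoning
    instance _ = ≢-nonZero α≢0
    c : QVec m
    c i = M i zero
    α = dot w c
    β = 1/ α

    -- Pairing the system with `w` leaves `α` times the first variable equal to 1, so `β` is its
    -- only possible value, and the right-hand side becomes `b - β * c`.
    eliminate : Solvable (λ i j → M i (suc j)) (λ i → b i - β * M i zero) ⊎
                Obstructed (λ i j → M i (suc j)) (λ i → b i - β * M i zero) → Solvable M b ⊎ Obstructed M b
    eliminate (inj₁ (y , My≡)) = inj₁ ((λ { zero → β ; (suc j) → y j }) ,
        λ i → trans (cong (λ q → M i zero * β + q) (My≡ i)) (cancel (M i zero) β (b i)))
      where
      cancel : ∀ c β b → c * β + (b - β * c) ≡ b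
      cancel = solve-∀ ℚ-ring
    eliminate (inj₂ (w′ , w′⊥ , w′b≡1)) = inj₂ (w″ , orth , trans (along b) (begin
        dot w′ b - γ * dot w b                        ≡⟨ cong (λ t → dot w′ b - γ * t) wb≡1 ⟩
        dot w′ b - γ * 1ℚ                             ≡⟨ regroup (dot w′ b) β (dot w′ c) ⟩
        dot w′ b - β * dot w′ c                       ≡⟨ dot-linear w′ b c β ⟨
        dot w′ (λ i → b i - β * c i)                  ≡⟨ w′b≡1 ⟩
        1ℚ                                            ∎))
      where
      -- The multiple of `w` whose subtraction makes `w′` orthogonal to the first column as well;
      -- the pairing with `b` then equals that of `w′` with `b - β * c`.
      γ = β * dot w′ c
      w″ : QVec m
      w″ i = w′ i - γ * w i
      regroup : ∀ x β y → x - (β * y) * 1ℚ ≡ x - β * y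
      regroup = solve-∀ ℚ-ring
      along : ∀ f → dot w″ f ≡ dot w′ f - γ * dot w f
      along f = trans (dot-comm w″ f) (trans (dot-linear f w′ w γ) (cong₂ (λ x y → x - γ * y) (dot-comm f w′) (dot-comm f w)))
      vanish : ∀ y β α → y - (β * y) * α ≡ y - y * (β * α)
      vanish = solve-∀ ℚ-ring
      vanish₁ : ∀ y → y - y * 1ℚ ≡ 0ℚ
      vanish₁ = solve-∀ ℚ-ring
      vanish₀ : ∀ γ → 0ℚ - γ * 0ℚ ≡ 0ℚ
      vanish₀ = solve-∀ ℚ-ring
      orth : ∀ j → dot w″ (λ i → M i j) ≡ 0ℚ
      orth zero    = begin
        dot w″ c                                      ≡⟨ along c ⟩
        dot w′ c - (β * dot w′ c) * α                 ≡⟨ vanish (dot w′ c) β α ⟩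
        dot w′ c - dot w′ c * (β * α)                 ≡⟨ cong (λ t → dot w′ c - dot w′ c * t) (ℚ.*-inverseˡ α) ⟩
        dot w′ c - dot w′ c * 1ℚ                      ≡⟨ vanish₁ (dot w′ c) ⟩
        0ℚ                                            ∎
      orth (suc j) = trans (along (λ i → M i (suc j))) (trans (cong₂ (λ x y → x - γ * y) (w′⊥ j) (w⊥ j)) (vanish₀ γ))

  -- A prime dividing none of finitely many denominators.

  prime-divisor : ∀ n → .{{ℕ.NonZero n}} → n ≢ 1 → Σ ℕ λ p → Prime p × p ∣ n
  prime-divisor n n≢1 with factorise n
  ... | record { factors = []     ; isFactorisation = n≡1 } = ⊥-elim (n≢1 n≡1)
  ... | record { factors = p ∷ ps ; isFactorisation = n≡  ; factorsPrime = p-prime ∷ _ } =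
        p , p-prime , subst (p ∣_) (sym n≡) (m∣m*n (product ps))

  -- A prime divisor of one plus the product of the denominators, as in Euclid's proof.
  prime-avoiding : ∀ (L : List ℚ) → Σ ℕ λ p → Prime p × (∀ {q} → q ∈ L → ¬ p ∣ ↧ₙ q)
  prime-avoiding L with prime-divisor (suc (product (map ↧ₙ_ L))) (ℕ.≢-nonZero⁻¹ _ {{product≢0 (nonzero L)}} ∘ ℕ.suc-injective)
    where
    nonzero : ∀ L → All ℕ.NonZero (map ↧ₙ_ L)
    nonzero []      = []
    nonzero (q ∷ L) = _ ∷ nonzero L
  ... | p , p-prime , p∣ = p , p-prime , λ q∈ p∣q → ¬prime[1] (subst Prime
        (∣1⇒≡1 (∣m+n∣m⇒∣n (subst (p ∣_) (ℕ.+-comm 1 _) p∣) (∣-trans p∣q (∈⇒∣product (∈-map⁺ ↧ₙ_ q∈))))) p-prime)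

  -- Divisibility in ℤ₍ₚ₎, valuations and the colouring by residues.

  module Adic (p : ℕ) (p-prime : Prime p) where

    instance
      p≢0 : ℕ.NonZero p
      p≢0 = prime⇒nonZero p-prime

    ι : ℤ → ℚ
    ι = fromℤ

    Unit : ℤ → Set
    Unit m = ¬ p ∣ ∣ m ∣

    unit-* : ∀ {m n} → Unit m → Unit n → Unit (m ℤ.* n)
    unit-* {m} {n} p∤m p∤n p∣mn =
      [ p∤m , p∤n ]′ (euclidsLemma ∣ m ∣ ∣ n ∣ p-prime (subst (p ∣_) (ℤ.abs-* m n) p∣mn))

    unit-1 : Unit (+ 1)
    unit-1 p∣1 = ¬prime[1] (subst Prime (∣1⇒≡1 p∣1) p-prime)

    unit-neg : ∀ {m} → Unit m → Unit (ℤ.- m)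
    unit-neg {m} p∤m p∣ = p∤m (subst (p ∣_) (ℤ.∣-i∣≡∣i∣ m) p∣)

    -- x ≺ y says that x ∈ pℤ₍ₚ₎ y.
    infix 4 _≺_
    record _≺_ (x y : ℚ) : Set where
      constructor witness
      field
        m n  : ℤ
        unit : Unit m
        eq   : ι m * x ≡ ι (+ p) * (ι n * y)

    ≺-zero : ∀ y → 0ℚ ≺ y
    ≺-zero y = witness (+ 1) (+ 0) unit-1 (zero-eq (ι (+ p)) y)
      where
      zero-eq : ∀ p y → 1ℚ * 0ℚ ≡ p * (0ℚ * y)
      zero-eq = solve-∀ ℚ-ring

    ≺-+ : ∀ {x x′ y} → x ≺ y → x′ ≺ y → x + x′ ≺ y
    ≺-+ {x} {x′} {y} (witness m n um eq) (witness m′ n′ um′ eq′) =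
      witness (m ℤ.* m′) (n ℤ.* m′ ℤ.+ n′ ℤ.* m) (unit-* {m} {m′} um um′) (begin
        ι (m ℤ.* m′) * (x + x′)                     ≡⟨ cong (_* (x + x′)) (fromℤ-* m m′) ⟩
        ι m * ι m′ * (x + x′)                       ≡⟨ split (ι m) (ι m′) x x′ ⟩
        ι m′ * (ι m * x) + ι m * (ι m′ * x′)        ≡⟨ cong₂ (λ s t → ι m′ * s + ι m * t) eq eq′ ⟩
        ι m′ * (ι (+ p) * (ι n * y)) + ι m * (ι (+ p) * (ι n′ * y))
                                                    ≡⟨ merge (ι m) (ι m′) (ι (+ p)) (ι n) (ι n′) y ⟩
        ι (+ p) * ((ι n * ι m′ + ι n′ * ι m) * y)   ≡⟨ cong (λ t → ι (+ p) * (t * y)) cast ⟨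
        ι (+ p) * (ι (n ℤ.* m′ ℤ.+ n′ ℤ.* m) * y)   ∎)
      where
      open ≡-Reasoning
      split : ∀ m m′ x x′ → m * m′ * (x + x′) ≡ m′ * (m * x) + m * (m′ * x′)
      split = solve-∀ ℚ-ring
      merge : ∀ m m′ p n n′ y → m′ * (p * (n * y)) + m * (p * (n′ * y)) ≡ p * ((n * m′ + n′ * m) * y)
      merge = solve-∀ ℚ-ring
      cast : ι (n ℤ.* m′ ℤ.+ n′ ℤ.* m) ≡ ι n * ι m′ + ι n′ * ι m
      cast = trans (fromℤ-+ (n ℤ.* m′) (n′ ℤ.* m)) (cong₂ _+_ (fromℤ-* n m′) (fromℤ-* n′ m))

    -- Such a `w` lies in ℤ₍ₚ₎, so multiplication by it preserves the ideal; its denominator is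
    -- absorbed into the unit.
    ≺-* : ∀ w {x y} → ¬ p ∣ ↧ₙ w → x ≺ y → w * x ≺ y
    ≺-* w {x} {y} p∤w (witness m n um eq) = witness (↧ w ℤ.* m) (↥ w ℤ.* n) (unit-* {↧ w} {m} p∤w um) (begin
        ι (↧ w ℤ.* m) * (w * x)            ≡⟨ cong (_* (w * x)) (fromℤ-* (↧ w) m) ⟩
        ι (↧ w) * ι m * (w * x)            ≡⟨ split (ι (↧ w)) (ι m) w x ⟩
        (ι (↧ w) * w) * (ι m * x)          ≡⟨ cong₂ _*_ (sym (fromℤ-↥ w)) eq ⟩
        ι (↥ w) * (ι (+ p) * (ι n * y))    ≡⟨ merge (ι (↥ w)) (ι (+ p)) (ι n) y ⟩
        ι (+ p) * (ι (↥ w) * ι n * y)      ≡⟨ cong (λ t → ι (+ p) * (t * y)) (fromℤ-* (↥ w) n) ⟨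
        ι (+ p) * (ι (↥ w ℤ.* n) * y)      ∎)
      where
      open ≡-Reasoning
      split : ∀ d m w x → d * m * (w * x) ≡ (d * w) * (m * x)
      split = solve-∀ ℚ-ring
      merge : ∀ w p n y → w * (p * (n * y)) ≡ p * (w * n * y)
      merge = solve-∀ ℚ-ring

    ≺-neg : ∀ {x y} → x ≺ y → - x ≺ y
    ≺-neg {x} {y} x≺y = subst (_≺ y) (minus x) (≺-* (- 1ℚ) unit-1 x≺y)
      where
      minus : ∀ x → (- 1ℚ) * x ≡ - x
      minus = solve-∀ ℚ-ring

    ≺-sumFin : ∀ n {f : Fin n → ℚ} {y} → (∀ i → f i ≺ y) → sumFin n f ≺ y
    ≺-sumFin zero    {y = y} f≺ = ≺-zero y
    ≺-sumFin (suc n) f≺ = ≺-+ (f≺ zero) (≺-sumFin n (f≺ ∘ suc))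

    -- Cancelling `y` would leave the unit `m` equal to `p` times an integer.
    ≺-irrefl : ∀ {y} → y ≢ 0ℚ → ¬ y ≺ y
    ≺-irrefl {y} y≢0 (witness m n um eq) = um (subst (p ∣_) (sym m≡) (m∣m*n ∣ n ∣))
      where
      regroup : ∀ y p n → p * (n * y) ≡ y * (p * n)
      regroup = solve-∀ ℚ-ring
      ιm≡ : ι m ≡ ι (+ p ℤ.* n)
      ιm≡ = trans (*-cancelˡ-nonzero y≢0 (trans (ℚ.*-comm y (ι m)) (trans eq (regroup y (ι (+ p)) (ι n)))))
                  (sym (fromℤ-* (+ p) n))
      m≡ : ∣ m ∣ ≡ p ℕ.* ∣ n ∣
      m≡ = trans (cong (∣_∣ ∘ ↥_) ιm≡) (ℤ.abs-* (+ p) n)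

    π : ℕ → ℤ
    π a = (+ p) ℤ.^ a

    strip-ℕ : ∀ n → n ≢ 0 → Σ ℕ λ a → Σ ℤ λ n′ → Unit n′ × + n ≡ π a ℤ.* n′
    strip-ℕ = <-rec _ step
      where
      step : ∀ n → (∀ {m} → m ℕ.< n → m ≢ 0 → Σ ℕ λ a → Σ ℤ λ n′ → Unit n′ × + m ≡ π a ℤ.* n′) →
        n ≢ 0 → Σ ℕ λ a → Σ ℤ λ n′ → Unit n′ × + n ≡ π a ℤ.* n′
      step n rec n≢0 with p ∣? n
      ... | no p∤n = 0 , + n , p∤n , sym (ℤ.*-identityˡ (+ n))
      ... | yes (divides q n≡qp) with rec (subst (q ℕ.<_) (sym n≡qp) q<qp) q≢0
        where
        q≢0 : q ≢ 0
        q≢0 q≡0 = n≢0 (trans n≡qp (cong (ℕ._* p) q≡0))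
        q<qp : q ℕ.< q ℕ.* p
        q<qp = ℕ.m<m*n q p {{ℕ.≢-nonZero q≢0}} (ℕ.nonTrivial⇒n>1 p {{prime⇒nonTrivial p-prime}})
      ...   | a , n′ , un′ , q≡ = suc a , n′ , un′ , (begin
        + n                         ≡⟨ cong (λ m → + m) n≡qp ⟩
        + (q ℕ.* p)                 ≡⟨ ℤ.pos-* q p ⟩
        + q ℤ.* + p                 ≡⟨ cong (ℤ._* + p) q≡ ⟩
        π a ℤ.* n′ ℤ.* + p          ≡⟨ rotate (π a) n′ (+ p) ⟩
        + p ℤ.* π a ℤ.* n′          ∎)
        where
        open ≡-Reasoning
        rotate : ∀ a n p → a ℤ.* n ℤ.* p ≡ p ℤ.* a ℤ.* n
        rotate = ℤ-Solver.solve-∀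

    strip : ∀ n → n ≢ + 0 → Σ ℕ λ a → Σ ℤ λ n′ → Unit n′ × n ≡ π a ℤ.* n′
    strip (+ n) n≢0 = strip-ℕ n (λ n≡0 → n≢0 (cong (λ m → + m) n≡0))
    strip -[1+ n ] n≢0 with strip-ℕ (suc n) (λ ())
    ... | a , n′ , un′ , eq = a , ℤ.- n′ , unit-neg {n′} un′ , trans (cong ℤ.-_ eq) (ℤ.neg-distribʳ-* (π a) n′)

    -- The factorisation of `x` as p^(a - b) n / d with `n` and `d` prime to `p`, multiplied out so
    -- that only natural exponents occur.
    record Normal (x : ℚ) : Set where
      field
        a b    : ℕ
        n d    : ℤ
        n-unit : Unit n
        d-unit : Unit d
        eq     : ι d * ι (π b) * x ≡ ι (π a) * ι n

      valuation : ℤ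
      valuation = + a ℤ.- + b

    normal : ∀ x → x ≢ 0ℚ → Normal x
    normal x x≢0 with strip (↥ x) (x≢0 ∘ ℚ.↥p≡0⇒p≡0 x) | strip (↧ x) (λ ())
    ... | a , n , un , n≡ | b , d , ud , d≡ = record
      { a = a ; b = b ; n = n ; d = d ; n-unit = un ; d-unit = ud ; eq = begin
        ι d * ι (π b) * x     ≡⟨ cong (_* x) (ℚ.*-comm (ι d) (ι (π b))) ⟩
        ι (π b) * ι d * x     ≡⟨ cong (_* x) (fromℤ-* (π b) d) ⟨
        ι (π b ℤ.* d) * x     ≡⟨ cong (λ t → ι t * x) d≡ ⟨
        ι (↧ x) * x           ≡⟨ fromℤ-↥ x ⟨
        ι (↥ x)               ≡⟨ cong ι n≡ ⟩
        ι (π a ℤ.* n)         ≡⟨ fromℤ-* (π a) n ⟩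
        ι (π a) * ι n         ∎ }
      where open ≡-Reasoning

    residue : ℤ → Fin p
    residue n = fromℕ< (n%ℕd<d n p)

    residue-≡ : ∀ m n → residue m ≡ residue n → Σ ℤ λ t → m ≡ n ℤ.+ + p ℤ.* t
    residue-≡ m n eq = (m /ℕ p) ℤ.- (n /ℕ p) , (begin
      m                                                         ≡⟨ a≡a%ℕn+[a/ℕn]*n m p ⟩
      + (m %ℕ p) ℤ.+ (m /ℕ p) ℤ.* + p                            ≡⟨ cong (λ r → + r ℤ.+ (m /ℕ p) ℤ.* + p) same ⟩
      + (n %ℕ p) ℤ.+ (m /ℕ p) ℤ.* + p                            ≡⟨ lemma (+ (n %ℕ p)) (m /ℕ p) (n /ℕ p) (+ p) ⟩
      (+ (n %ℕ p) ℤ.+ (n /ℕ p) ℤ.* + p) ℤ.+ + p ℤ.* ((m /ℕ p) ℤ.- (n /ℕ p))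
                                                                ≡⟨ cong (ℤ._+ + p ℤ.* ((m /ℕ p) ℤ.- (n /ℕ p))) (a≡a%ℕn+[a/ℕn]*n n p) ⟨
      n ℤ.+ + p ℤ.* ((m /ℕ p) ℤ.- (n /ℕ p))                      ∎)
      where
      open ≡-Reasoning
      same : m %ℕ p ≡ n %ℕ p
      same = Fin.fromℕ<-injective _ _ (n%ℕd<d m p) (n%ℕd<d n p) eq
      lemma : ∀ r a b p → r ℤ.+ a ℤ.* p ≡ (r ℤ.+ b ℤ.* p) ℤ.+ p ℤ.* (a ℤ.- b)
      lemma = ℤ-Solver.solve-∀

    -- This determines the unit part n / d modulo `p`; keeping the two residues apart avoids
    -- inversion modulo `p`.
    adic-colour : ∀ {x} → Normal x → Fin (p ℕ.* p)
    adic-colour X = combine (residue (Normal.n X)) (residue (Normal.d X))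

    π≢0 : ∀ a → ι (π a) ≢ 0ℚ
    π≢0 a = fromℤ-nonzero {π a} (λ πa≡0 → ℕ.≢-nonZero⁻¹ p (cong ∣_∣ (ℤ.i^n≡0⇒i≡0 (+ p) a πa≡0)))

    π-+ : ∀ a b → ι (π (a ℕ.+ b)) ≡ ι (π a) * ι (π b)
    π-+ a b = trans (cong ι (ℤ.^-distribˡ-+-* (+ p) a b)) (fromℤ-* (π a) (π b))

    module Compare {x y} (X : Normal x) (Y : Normal y) where
      private
        module X = Normal X
        module Y = Normal Y
      open ≡-Reasoning

      -- The two normal forms multiplied crosswise. The exponents of `p` are natural numbers, and
      -- their difference is the difference of the valuations.
      cross : ι (π (Y.a ℕ.+ X.b)) * (ι Y.n * ι X.d * x) ≡ ι (π (X.a ℕ.+ Y.b)) * (ι X.n * ι Y.d * y)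
      cross = begin
        ι (π (Y.a ℕ.+ X.b)) * (ι Y.n * ι X.d * x)           ≡⟨ cong (_* (ι Y.n * ι X.d * x)) (π-+ Y.a X.b) ⟩
        ι (π Y.a) * ι (π X.b) * (ι Y.n * ι X.d * x)         ≡⟨ left (ι (π Y.a)) (ι (π X.b)) (ι Y.n) (ι X.d) x ⟩
        (ι X.d * ι (π X.b) * x) * (ι (π Y.a) * ι Y.n)       ≡⟨ cong₂ _*_ X.eq (sym Y.eq) ⟩
        (ι (π X.a) * ι X.n) * (ι Y.d * ι (π Y.b) * y)       ≡⟨ right (ι (π X.a)) (ι X.n) (ι Y.d) (ι (π Y.b)) y ⟩
        ι (π X.a) * ι (π Y.b) * (ι X.n * ι Y.d * y)         ≡⟨ cong (_* (ι X.n * ι Y.d * y)) (π-+ X.a Y.b) ⟨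
        ι (π (X.a ℕ.+ Y.b)) * (ι X.n * ι Y.d * y)           ∎
        where
        left : ∀ a b n d x → a * b * (n * d * x) ≡ (d * b * x) * (a * n)
        left = solve-∀ ℚ-ring
        right : ∀ a n d b y → (a * n) * (d * b * y) ≡ a * b * (n * d * y)
        right = solve-∀ ℚ-ring

      cross-exponents : ∀ {e f} → (+ X.a ℤ.- + X.b) ℤ.+ (+ X.b ℤ.+ + Y.b) ≡ e →
        (+ Y.a ℤ.- + Y.b) ℤ.+ (+ X.b ℤ.+ + Y.b) ≡ f → e ≡ + (X.a ℕ.+ Y.b) × f ≡ + (Y.a ℕ.+ X.b)
      cross-exponents refl refl = lemma₁ (+ X.a) (+ X.b) (+ Y.b) , lemma₂ (+ Y.a) (+ X.b) (+ Y.b)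
        where
        lemma₁ : ∀ a b b′ → (a ℤ.- b) ℤ.+ (b ℤ.+ b′) ≡ a ℤ.+ b′
        lemma₁ = ℤ-Solver.solve-∀
        lemma₂ : ∀ a b b′ → (a ℤ.- b′) ℤ.+ (b ℤ.+ b′) ≡ a ℤ.+ b
        lemma₂ = ℤ-Solver.solve-∀

      unit-cross : Unit (Y.n ℤ.* X.d)
      unit-cross = unit-* {Y.n} {X.d} Y.n-unit X.d-unit

      ≺-larger-valuation : Y.valuation ℤ.< X.valuation → x ≺ y
      ≺-larger-valuation v<v′ with ℕ.m≤n⇒∃[o]m+o≡n ya+xb<xa+yb
        where
        ya+xb<xa+yb : Y.a ℕ.+ X.b ℕ.< X.a ℕ.+ Y.b
        ya+xb<xa+yb = ℤ.drop‿+<+ (subst₂ ℤ._<_ (proj₂ (cross-exponents refl refl)) (proj₁ (cross-exponents refl refl))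
          (ℤ.+-monoˡ-< (+ X.b ℤ.+ + Y.b) v<v′))
      -- Here `k` is one less than the difference of the exponents: the remaining factor `p` is the
      -- one that `≺` asks for.
      ... | k , e≡ = witness (Y.n ℤ.* X.d) (π k ℤ.* (X.n ℤ.* Y.d)) unit-cross (*-cancelˡ-nonzero (π≢0 (Y.a ℕ.+ X.b)) (begin
        P * (ι (Y.n ℤ.* X.d) * x)                           ≡⟨ cong (λ t → P * (t * x)) (fromℤ-* Y.n X.d) ⟩
        P * (ι Y.n * ι X.d * x)                             ≡⟨ cross ⟩
        ι (π (X.a ℕ.+ Y.b)) * (ι X.n * ι Y.d * y)           ≡⟨ cong (λ e → ι (π e) * (ι X.n * ι Y.d * y)) e≡ ⟨
        ι (+ p ℤ.* π (Y.a ℕ.+ X.b ℕ.+ k)) * (ι X.n * ι Y.d * y)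
          ≡⟨ cong (_* (ι X.n * ι Y.d * y)) (trans (fromℤ-* (+ p) _) (cong (ι (+ p) *_) (π-+ (Y.a ℕ.+ X.b) k))) ⟩
        ι (+ p) * (P * ι (π k)) * (ι X.n * ι Y.d * y)       ≡⟨ regroup (ι (+ p)) P (ι (π k)) (ι X.n * ι Y.d) y ⟩
        P * (ι (+ p) * (ι (π k) * (ι X.n * ι Y.d) * y))     ≡⟨ cong (λ t → P * (ι (+ p) * (t * y))) cast ⟨
        P * (ι (+ p) * (ι (π k ℤ.* (X.n ℤ.* Y.d)) * y))     ∎))
        where
        P = ι (π (Y.a ℕ.+ X.b))
        regroup : ∀ p P k c y → p * (P * k) * (c * y) ≡ P * (p * (k * c * y))
        regroup = solve-∀ ℚ-ring
        cast : ι (π k ℤ.* (X.n ℤ.* Y.d)) ≡ ι (π k) * (ι X.n * ι Y.d)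
        cast = trans (fromℤ-* (π k) (X.n ℤ.* Y.d)) (cong (ι (π k) *_) (fromℤ-* X.n Y.d))

      -- The powers of `p` cancel, so x / y is `X.n * Y.d` over `Y.n * X.d`. Equal residues make
      -- these two products congruent modulo `p`, and the denominator is a unit.
      ≺-equal-valuation : X.valuation ≡ Y.valuation → adic-colour X ≡ adic-colour Y → x - y ≺ y
      ≺-equal-valuation v≡v′ c≡c′
        with residue-≡ X.n Y.n (Fin.combine-injectiveˡ _ _ _ _ c≡c′)
           | residue-≡ Y.d X.d (sym (Fin.combine-injectiveʳ (residue X.n) _ (residue Y.n) _ c≡c′))
      ... | s , n≡ | t , d≡ = witness (Y.n ℤ.* X.d) r unit-cross (begin
        ι (Y.n ℤ.* X.d) * (x - y)                                ≡⟨ expand (ι (Y.n ℤ.* X.d)) x y ⟩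
        ι (Y.n ℤ.* X.d) * x + - ι (Y.n ℤ.* X.d) * y              ≡⟨ cong (_+ - ι (Y.n ℤ.* X.d) * y) same-size ⟩
        ι (X.n ℤ.* Y.d) * y + - ι (Y.n ℤ.* X.d) * y              ≡⟨ ℚ.*-distribʳ-+ y (ι (X.n ℤ.* Y.d)) (- ι (Y.n ℤ.* X.d)) ⟨
        (ι (X.n ℤ.* Y.d) + - ι (Y.n ℤ.* X.d)) * y                ≡⟨ cong (λ q → (ι (X.n ℤ.* Y.d) + q) * y) (fromℤ-neg (Y.n ℤ.* X.d)) ⟨
        (ι (X.n ℤ.* Y.d) + ι (ℤ.- (Y.n ℤ.* X.d))) * y            ≡⟨ cong (_* y) (fromℤ-+ (X.n ℤ.* Y.d) (ℤ.- (Y.n ℤ.* X.d))) ⟨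
        ι (X.n ℤ.* Y.d ℤ.- Y.n ℤ.* X.d) * y                      ≡⟨ cong (λ q → ι q * y) difference ⟩
        ι (+ p ℤ.* r) * y                                        ≡⟨ cong (_* y) (fromℤ-* (+ p) r) ⟩
        ι (+ p) * ι r * y                                        ≡⟨ ℚ.*-assoc (ι (+ p)) (ι r) y ⟩
        ι (+ p) * (ι r * y)                                      ∎)
        where
        r = s ℤ.* (X.d ℤ.+ + p ℤ.* t) ℤ.+ Y.n ℤ.* t
        exponents : X.a ℕ.+ Y.b ≡ Y.a ℕ.+ X.b
        exponents = ℤ.+-injective (trans (sym (proj₁ (cross-exponents refl refl)))
          (trans (cong (ℤ._+ (+ X.b ℤ.+ + Y.b)) v≡v′) (proj₂ (cross-exponents refl refl))))
        same-size : ι (Y.n ℤ.* X.d) * x ≡ ι (X.n ℤ.* Y.d) * y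
        same-size = trans (cong (_* x) (fromℤ-* Y.n X.d)) (trans
          (*-cancelˡ-nonzero (π≢0 (Y.a ℕ.+ X.b)) (trans cross (cong (λ e → ι (π e) * (ι X.n * ι Y.d * y)) exponents)))
          (cong (_* y) (sym (fromℤ-* X.n Y.d))))
        expand : ∀ m x y → m * (x - y) ≡ m * x + - m * y
        expand = solve-∀ ℚ-ring
        polynomial : ∀ n d p s t → (n ℤ.+ p ℤ.* s) ℤ.* (d ℤ.+ p ℤ.* t) ℤ.- n ℤ.* d ≡ p ℤ.* (s ℤ.* (d ℤ.+ p ℤ.* t) ℤ.+ n ℤ.* t)
        polynomial = ℤ-Solver.solve-∀
        difference : X.n ℤ.* Y.d ℤ.- Y.n ℤ.* X.d ≡ + p ℤ.* r
        difference = trans (cong₂ (λ u v → u ℤ.* v ℤ.- Y.n ℤ.* X.d) n≡ d≡) (polynomial Y.n X.d (+ p) s t)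

  -- From a monochromatic image to the columns condition.

  firstEntryOne-cong : ∀ {n} {r s : QVec n} → (∀ t → r t ≡ s t) → FirstEntryOne r → FirstEntryOne s
  firstEntryOne-cong {suc n} eq (inj₁ r₀≡1)        = inj₁ (trans (sym (eq zero)) r₀≡1)
  firstEntryOne-cong {suc n} eq (inj₂ (r₀≡0 , fe)) =
    inj₂ (trans (sym (eq zero)) r₀≡0 , firstEntryOne-cong (eq ∘ suc) fe)

  dot-· : ∀ {m n} (w : QVec m) (M : Matrix m n) (x : QVec n) →
    dot w (M · x) ≡ dot (λ j → dot w (λ i → M i j)) x
  dot-· {m} {n} w M x = begin
    sumFin m (λ i → w i * sumFin n (λ j → M i j * x j))     ≡⟨ sumFin-cong m (λ i → sym (*-sumFin n (w i) _)) ⟩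
    sumFin m (λ i → sumFin n (λ j → w i * (M i j * x j)))   ≡⟨ sumFin-swap m n _ ⟩
    sumFin n (λ j → sumFin m (λ i → w i * (M i j * x j)))
      ≡⟨ sumFin-cong n (λ j → trans (sumFin-cong m (λ i → sym (ℚ.*-assoc (w i) (M i j) (x j)))) (sumFin-* m (x j) _)) ⟩
    sumFin n (λ j → sumFin m (λ i → w i * M i j) * x j)     ∎
    where open ≡-Reasoning

  -- A label records whether a row is discarded (0F) or prescribed to take the value one (1F) or zero (2F).
  mask target : Fin 3 → ℚ
  mask 0F = 0ℚ
  mask 1F = 1ℚ
  mask 2F = 1ℚ
  target 0F = 0ℚ
  target 1F = 1ℚ
  target 2F = 0ℚ

  masked : ∀ {u v} → Matrix u v → (Fin u → Fin 3) → Matrix u v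
  masked A ℓ i j = mask (ℓ i) * A i j

  masked-· : ∀ {u v} (A : Matrix u v) ℓ x i → (masked A ℓ · x) i ≡ mask (ℓ i) * (A · x) i
  masked-· {v = v} A ℓ x i = trans (sumFin-cong v (λ j → ℚ.*-assoc (mask (ℓ i)) (A i j) (x j))) (*-sumFin v (mask (ℓ i)) _)

  -- The columns condition restricted to the rows in `J`, in column-reduced form: `dual` exhibits an
  -- identity submatrix in the rows `rep`. The vectors `Y` are rational and need not lie in the
  -- subgroup.
  record FirstEntriesForm {u v} (A : Matrix u v) (J : List (Fin u)) : Set where
    field
      size  : ℕ
      Y     : Fin size → QVec v
      rep   : Fin size → Fin u
      rep∈  : ∀ s → rep s ∈ J
      first : ∀ {i} → i ∈ J → FirstEntryOne (λ t → (A · Y t) i)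
      dual  : ∀ s t → (A · Y t) (rep s) ≡ δ s t

  alternative : ∀ {u v} (A : Matrix u v) ℓ → Solvable (masked A ℓ) (target ∘ ℓ) ⊎ Obstructed (masked A ℓ) (target ∘ ℓ)
  alternative {v = v} A ℓ = fredholm v (masked A ℓ) (target ∘ ℓ)

  -- The default 0 has denominator 1, so solvable systems put no constraint on the prime.
  functional : ∀ {u v} {M : Matrix u v} {b} → Solvable M b ⊎ Obstructed M b → QVec u
  functional (inj₁ _)       i = 0ℚ
  functional (inj₂ (w , _)) = w

  module Extraction {u v} (A : Matrix u v) (p : ℕ) (p-prime : Prime p)
    (p∤functional : ∀ e i → ¬ p ∣ ↧ₙ (functional (alternative A (finToFun e)) i))
    (x : QVec v) (z≢0 : ∀ i → (A · x) i ≢ 0ℚ) (val : Fin u → ℤ)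
    (larger : ∀ i k → val k ℤ.< val i → Adic._≺_ p p-prime ((A · x) i) ((A · x) k))
    (equal : ∀ i k → val i ≡ val k → Adic._≺_ p p-prime ((A · x) i - (A · x) k) ((A · x) k)) where

    open Adic p p-prime

    z = A · x

    -- The label agrees with the residue of z i / z i₀ modulo `p`, which is 1 for `1F` and 0 for
    -- `2F`; a discarded row is unconstrained.
    Fits : Fin u → Fin u → Fin 3 → Set
    Fits i₀ i 0F = ⊤
    Fits i₀ i 1F = z i - z i₀ ≺ z i₀
    Fits i₀ i 2F = z i ≺ z i₀

    fits⇒≺ : ∀ i₀ i l → Fits i₀ i l → target l * z i₀ - mask l * z i ≺ z i₀
    fits⇒≺ i₀ i 0F _    = subst (_≺ z i₀) (eq (z i₀) (z i)) (≺-zero (z i₀))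
      where
      eq : ∀ y x → 0ℚ ≡ 0ℚ * y - 0ℚ * x
      eq = solve-∀ ℚ-ring
    fits⇒≺ i₀ i 1F x-y≺y = subst (_≺ z i₀) (eq (z i₀) (z i)) (≺-neg x-y≺y)
      where
      eq : ∀ y x → - (x - y) ≡ 1ℚ * y - 1ℚ * x
      eq = solve-∀ ℚ-ring
    fits⇒≺ i₀ i 2F x≺y  = subst (_≺ z i₀) (eq (z i₀) (z i)) (≺-neg x≺y)
      where
      eq : ∀ y x → - x ≡ 0ℚ * y - 1ℚ * x
      eq = solve-∀ ℚ-ring

    -- An obstruction `w` annihilates the masked image of `x` and pairs to 1 with the target, so the
    -- `w`-weighted sum of the errors `target * z i₀ - mask * z i` is `z i₀` itself. Each error lies
    -- in pℤ₍ₚ₎ z i₀ and `w` has entries in ℤ₍ₚ₎, contradicting `≺-irrefl`.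
    solvable : ∀ {ℓ} i₀ → (∀ i → Fits i₀ i (ℓ i)) →
      (alt : Solvable (masked A ℓ) (target ∘ ℓ) ⊎ Obstructed (masked A ℓ) (target ∘ ℓ)) →
      (∀ i → ¬ p ∣ ↧ₙ (functional alt i)) → Solvable (masked A ℓ) (target ∘ ℓ)
    solvable i₀ fits (inj₁ sol) p∤ = sol
    solvable {ℓ} i₀ fits (inj₂ (w , w⊥ , wt≡1)) p∤ = ⊥-elim (≺-irrefl (z≢0 i₀) (subst (_≺ z i₀) sum≡
        (≺-sumFin u (λ i → ≺-* (w i) (p∤ i) (fits⇒≺ i₀ i (ℓ i) (fits i))))))
      where
      open ≡-Reasoning
      expand : ∀ w t y r → w * (t * y - r) ≡ (w * t) * y + (- 1ℚ) * (w * r)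
      expand = solve-∀ ℚ-ring
      collect : ∀ y → 1ℚ * y + (- 1ℚ) * 0ℚ ≡ y
      collect = solve-∀ ℚ-ring
      annihilates : sumFin u (λ i → w i * (mask (ℓ i) * z i)) ≡ 0ℚ
      annihilates = begin
        sumFin u (λ i → w i * (mask (ℓ i) * z i))                ≡⟨ sumFin-cong u (λ i → cong (w i *_) (sym (masked-· A ℓ x i))) ⟩
        dot w (masked A ℓ · x)                                   ≡⟨ dot-· w (masked A ℓ) x ⟩
        dot (λ j → dot w (λ i → masked A ℓ i j)) x               ≡⟨ sumFin-zero v (λ j → trans (cong (_* x j) (w⊥ j)) (ℚ.*-zeroˡ (x j))) ⟩
        0ℚ                                                       ∎
      sum≡ : sumFin u (λ i → w i * (target (ℓ i) * z i₀ - mask (ℓ i) * z i)) ≡ z i₀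
      sum≡ = begin
        sumFin u (λ i → w i * (target (ℓ i) * z i₀ - mask (ℓ i) * z i))
          ≡⟨ sumFin-cong u (λ i → expand (w i) (target (ℓ i)) (z i₀) (mask (ℓ i) * z i)) ⟩
        sumFin u (λ i → (w i * target (ℓ i)) * z i₀ + (- 1ℚ) * (w i * (mask (ℓ i) * z i)))
          ≡⟨ sumFin-+ u _ _ ⟩
        sumFin u (λ i → (w i * target (ℓ i)) * z i₀) + sumFin u (λ i → (- 1ℚ) * (w i * (mask (ℓ i) * z i)))
          ≡⟨ cong₂ _+_ (trans (sumFin-* u (z i₀) _) (cong (_* z i₀) wt≡1))
                       (trans (*-sumFin u (- 1ℚ) _) (cong ((- 1ℚ) *_) annihilates)) ⟩
        1ℚ * z i₀ + (- 1ℚ) * 0ℚ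
          ≡⟨ collect (z i₀) ⟩
        z i₀ ∎

    -- The prime was chosen for labellings of the form `finToFun e`, so `ℓ` is replaced by its
    -- decoded code, which agrees with it pointwise.
    prescribe : ∀ ℓ i₀ → (∀ i → Fits i₀ i (ℓ i)) → Σ (QVec v) λ y → ∀ i → mask (ℓ i) * (A · y) i ≡ target (ℓ i)
    prescribe ℓ i₀ fits with solvable i₀ (λ i → subst (Fits i₀ i) (sym (decode i)) (fits i))
                               (alternative A (finToFun e)) (p∤functional e)
      where
      e = funToFin ℓ
      decode : ∀ i → finToFun e i ≡ ℓ i
      decode = Fin.finToFun-funToFin ℓ
    ... | y , eq = y , λ i → trans
      (cong (λ l → mask l * (A · y) i) (sym (Fin.finToFun-funToFin ℓ i)))
      (trans (sym (masked-· A (finToFun (funToFin ℓ)) y i)) (trans (eq i) (cong target (Fin.finToFun-funToFin ℓ i))))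

    open DecMembership (Fin._≟_ {u}) using (_∈?_)

    -- Rows of `J` at the least valuation are to take the value 1 and the higher ones 0. Rows
    -- outside `J` are left free: in `extract` an earlier column already gives them their leading 1.
    module Stratum (J : List (Fin u)) (i₀ : Fin u) (minimal : ∀ {i} → i ∈ J → val i₀ ℤ.≤ val i) where

      label : Fin u → Fin 3
      label i with i ∈? J | val i₀ ℤ.<? val i
      ... | no _  | _     = 0F
      ... | yes _ | no _  = 1F
      ... | yes _ | yes _ = 2F

      label-fits : ∀ i → Fits i₀ i (label i)
      label-fits i with i ∈? J | val i₀ ℤ.<? val i
      ... | no _    | _     = tt
      ... | yes i∈J | no ≮  = equal i i₀ (ℤ.≤-antisym (ℤ.≮⇒≥ ≮) (minimal i∈J))
      ... | yes _   | yes < = larger i i₀ <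

      y : QVec v
      y = proj₁ (prescribe label i₀ label-fits)

      value : ∀ {i l} → label i ≡ l → mask l * (A · y) i ≡ target l
      value {i} refl = proj₂ (prescribe label i₀ label-fits) i

      value-1 : ∀ {i} → i ∈ J → ¬ val i₀ ℤ.< val i → (A · y) i ≡ 1ℚ
      value-1 {i} i∈J ≮ = trans (sym (ℚ.*-identityˡ _)) (value label≡)
        where
        label≡ : label i ≡ 1F
        label≡ with i ∈? J | val i₀ ℤ.<? val i
        ... | no i∉J | _     = ⊥-elim (i∉J i∈J)
        ... | yes _  | no _  = refl
        ... | yes _  | yes < = ⊥-elim (≮ <)

      value-0 : ∀ {i} → i ∈ J → val i₀ ℤ.< val i → (A · y) i ≡ 0ℚ
      value-0 {i} i∈J < = trans (sym (ℚ.*-identityˡ _)) (value label≡)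
        where
        label≡ : label i ≡ 2F
        label≡ with i ∈? J | val i₀ ℤ.<? val i
        ... | no i∉J | _     = ⊥-elim (i∉J i∈J)
        ... | yes _  | no ≮  = ⊥-elim (≮ <)
        ... | yes _  | yes _ = refl

    -- One column per valuation, in increasing order. The list `K` of higher rows is shorter than
    -- `J` since it loses `i₀`, and `n` bounds the length to make the recursion structural.
    extract : ∀ n (J : List (Fin u)) → length J ℕ.≤ n → FirstEntriesForm A J
    extract n [] _ = record
      { size = 0 ; Y = λ () ; rep = λ () ; rep∈ = λ () ; first = λ () ; dual = λ () }
    extract (suc n) J@(j ∷ js) (ℕ.s≤s len≤) = record
      { size  = suc C.size
      ; Y     = Y
      ; rep   = λ { zero → i₀ ; (suc s) → C.rep s }
      ; rep∈  = λ { zero → i₀∈J ; (suc s) → proj₁ (split (C.rep∈ s)) }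
      ; first = first
      ; dual  = λ
        { zero    zero    → L.value-1 i₀∈J (ℤ.<-irrefl refl)
        ; zero    (suc t) → trans (A·Y t i₀) (trans
            (cong (λ q → (A · C.Y t) i₀ - (A · C.Y t) i₀ * q) (L.value-1 i₀∈J (ℤ.<-irrefl refl))) (cancel ((A · C.Y t) i₀)))
        ; (suc s) zero    → L.value-0 (proj₁ (split (C.rep∈ s))) (proj₂ (split (C.rep∈ s)))
        ; (suc s) (suc t) → trans (unchanged (C.rep∈ s) t) (C.dual s t) }
      }
      where
      i₀ = argmin val j js

      i₀∈J : i₀ ∈ J
      i₀∈J with argmin-sel val j js
      ... | inj₁ i₀≡j = here i₀≡j
      ... | inj₂ i₀∈  = there i₀∈

      minimal : ∀ {i} → i ∈ J → val i₀ ℤ.≤ val i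
      minimal (here refl) = f[argmin]≤f[⊤] {f = val} j js
      minimal (there i∈)  = All.lookup (f[argmin]≤f[xs] {f = val} j js) i∈

      module L = Stratum J i₀ minimal

      above? : ∀ i → Dec (val i₀ ℤ.< val i)
      above? i = val i₀ ℤ.<? val i
      K = filter above? J

      split : ∀ {i} → i ∈ K → i ∈ J × val i₀ ℤ.< val i
      split = ∈-filter⁻ above? {xs = J}

      module C = FirstEntriesForm (extract n K
        (ℕ.≤-pred (ℕ.≤-trans (filter-notAll above? J (lose i₀∈J (ℤ.<-irrefl refl))) (ℕ.s≤s len≤))))

      Y : Fin (suc C.size) → QVec v
      Y zero      = L.y
      -- Column reduction: the later columns are cleared in row `i₀`. Rows in `K` do not change,
      -- because `A · L.y` vanishes there.
      Y (suc t) j = C.Y t j - (A · C.Y t) i₀ * L.y j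

      A·Y : ∀ t i → (A · Y (suc t)) i ≡ (A · C.Y t) i - (A · C.Y t) i₀ * (A · L.y) i
      A·Y t i = dot-linear (A i) (C.Y t) L.y ((A · C.Y t) i₀)

      cancel : ∀ q → q - q * 1ℚ ≡ 0ℚ
      cancel = solve-∀ ℚ-ring
      drop : ∀ q r → q - r * 0ℚ ≡ q
      drop = solve-∀ ℚ-ring

      unchanged : ∀ {i} → i ∈ K → ∀ t → (A · Y (suc t)) i ≡ (A · C.Y t) i
      unchanged {i} i∈K t = trans (A·Y t i) (trans
        (cong (λ q → (A · C.Y t) i - (A · C.Y t) i₀ * q) (L.value-0 (proj₁ (split i∈K)) (proj₂ (split i∈K))))
        (drop ((A · C.Y t) i) ((A · C.Y t) i₀)))

      first : ∀ {i} → i ∈ J → FirstEntryOne (λ t → (A · Y t) i)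
      first {i} i∈J with above? i
      ... | no ≮  = inj₁ (L.value-1 i∈J ≮)
      ... | yes < = inj₂ (L.value-0 i∈J < , firstEntryOne-cong (λ t → sym (unchanged i∈K t)) (C.first i∈K))
        where
        i∈K : i ∈ K
        i∈K = ∈-filter⁺ above? i∈J <

  -- The order of choices matters: the obstructions of all 3^u labelled systems depend on `A` alone,
  -- then comes the prime, then the colouring with `p * p` colours, and only then `x`.
  firstEntriesForm : ∀ {S u v} (A : Matrix u v) → WeaklyIPR S A → FirstEntriesForm A (allFin u)
  firstEntriesForm {S} {u} A ipr with prime-avoiding
    (cartesianProductWith (λ e → functional (alternative A (finToFun e))) (allFin (3 ℕ.^ u)) (allFin u))
  ... | p , p-prime , avoids with ipr (p ℕ.* p) (λ { (q , _ , q≢0) → Adic.adic-colour p p-prime (Adic.normal p p-prime q q≢0) })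
  ...   | x , _ , _ , mono = Extraction.extract A p p-prime
          (λ e i → avoids (∈-cartesianProductWith⁺ _ (∈-allFin e) (∈-allFin i)))
          x z≢0 (λ i → Normal.valuation (form i))
          (λ i k → Compare.≺-larger-valuation (form i) (form k))
          (λ i k v≡ → Compare.≺-equal-valuation (form i) (form k) v≡
            (trans (proj₂ (proj₂ (mono i))) (sym (proj₂ (proj₂ (mono k))))))
          (length (allFin u)) (allFin u) ℕ.≤-refl
    where
    open Adic p p-prime
    z≢0 : ∀ i → (A · x) i ≢ 0ℚ
    z≢0 i = proj₁ (proj₂ (mono i))
    form : ∀ i → Normal ((A · x) i)
    form i = normal ((A · x) i) (z≢0 i)

  -- Vectors of length 3u in three blocks.

  sumFin-split : ∀ m n (f : Fin (m ℕ.+ n) → ℚ) →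
    sumFin (m ℕ.+ n) f ≡ sumFin m (f ∘ (_↑ˡ n)) + sumFin n (f ∘ (m ↑ʳ_))
  sumFin-split zero    n f = sym (ℚ.+-identityˡ _)
  sumFin-split (suc m) n f = trans (cong (λ q → f zero + q) (sumFin-split m n (f ∘ suc))) (sym (ℚ.+-assoc (f zero) _ _))

  module Blocks (u : ℕ) where

    -- The nesting follows the computation of `3 * u` to `u + (u + (u + 0))`.
    zᵢ xᵢ yᵢ : Fin u → Fin (3 ℕ.* u)
    zᵢ i = i ↑ˡ (u ℕ.+ (u ℕ.+ 0))
    xᵢ i = u ↑ʳ (i ↑ˡ (u ℕ.+ 0))
    yᵢ i = u ↑ʳ (u ↑ʳ (i ↑ˡ 0))

    module _ {X : Set} (f g h : Fin u → X) where

      blocks : Fin (3 ℕ.* u) → X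
      blocks = [ f , [ g , [ h , (λ ()) ]′ ∘ splitAt u ]′ ∘ splitAt u ]′ ∘ splitAt u

      blocks-z : ∀ i → blocks (zᵢ i) ≡ f i
      blocks-z i rewrite Fin.splitAt-↑ˡ u i (u ℕ.+ (u ℕ.+ 0)) = refl

      blocks-x : ∀ i → blocks (xᵢ i) ≡ g i
      blocks-x i rewrite Fin.splitAt-↑ʳ u (u ℕ.+ (u ℕ.+ 0)) (i ↑ˡ (u ℕ.+ 0)) | Fin.splitAt-↑ˡ u i (u ℕ.+ 0) = refl

      blocks-y : ∀ i → blocks (yᵢ i) ≡ h i
      blocks-y i rewrite Fin.splitAt-↑ʳ u (u ℕ.+ (u ℕ.+ 0)) (u ↑ʳ (i ↑ˡ 0)) | Fin.splitAt-↑ʳ u (u ℕ.+ 0) (i ↑ˡ 0)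
        | Fin.splitAt-↑ˡ u i 0 = refl

      blocks-elim : ∀ (P : X → Set) → (∀ i → P (f i)) → (∀ i → P (g i)) → (∀ i → P (h i)) → ∀ k → P (blocks k)
      blocks-elim P pf pg ph k with splitAt u k
      ... | inj₁ i = pf i
      ... | inj₂ k′ with splitAt u k′
      ...   | inj₁ i = pg i
      ...   | inj₂ k″ with splitAt u k″
      ...     | inj₁ i = ph i

    dot-blocks : ∀ (f g h : QVec u) (s : QVec (3 ℕ.* u)) →
      dot (blocks f g h) s ≡ dot f (s ∘ zᵢ) + dot g (s ∘ xᵢ) + dot h (s ∘ yᵢ)
    dot-blocks f g h s = begin
      dot (blocks f g h) s
        ≡⟨ sumFin-split u (u ℕ.+ (u ℕ.+ 0)) term ⟩
      sumFin u (term ∘ zᵢ) + sumFin (u ℕ.+ (u ℕ.+ 0)) (term ∘ (u ↑ʳ_))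
        ≡⟨ cong (λ q → sumFin u (term ∘ zᵢ) + q) (sumFin-split u (u ℕ.+ 0) (term ∘ (u ↑ʳ_))) ⟩
      sumFin u (term ∘ zᵢ) + (sumFin u (term ∘ xᵢ) + sumFin (u ℕ.+ 0) (term ∘ (u ↑ʳ_) ∘ (u ↑ʳ_)))
        ≡⟨ cong (λ q → sumFin u (term ∘ zᵢ) + (sumFin u (term ∘ xᵢ) + q)) (sumFin-split u 0 (term ∘ (u ↑ʳ_) ∘ (u ↑ʳ_))) ⟩
      sumFin u (term ∘ zᵢ) + (sumFin u (term ∘ xᵢ) + (sumFin u (term ∘ yᵢ) + 0ℚ))
        ≡⟨ regroup (sumFin u (term ∘ zᵢ)) (sumFin u (term ∘ xᵢ)) (sumFin u (term ∘ yᵢ)) ⟩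
      sumFin u (term ∘ zᵢ) + sumFin u (term ∘ xᵢ) + sumFin u (term ∘ yᵢ)
        ≡⟨ cong₂ _+_ (cong₂ _+_
             (sumFin-cong u (λ i → cong (_* s (zᵢ i)) (blocks-z f g h i)))
             (sumFin-cong u (λ i → cong (_* s (xᵢ i)) (blocks-x f g h i))))
             (sumFin-cong u (λ i → cong (_* s (yᵢ i)) (blocks-y f g h i))) ⟩
      dot f (s ∘ zᵢ) + dot g (s ∘ xᵢ) + dot h (s ∘ yᵢ) ∎
      where
      open ≡-Reasoning
      term : Fin (3 ℕ.* u) → ℚ
      term k = blocks f g h k * s k
      regroup : ∀ a b c → a + (b + (c + 0ℚ)) ≡ a + b + c
      regroup = solve-∀ ℚ-ring

  -- The matrix D, its partition regularity and its solutions.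

  dot-δ-scaled : ∀ {n} c (i : Fin n) f → dot (λ l → c * δ i l) f ≡ c * f i
  dot-δ-scaled {n} c i f = trans (sumFin-cong n (λ l → ℚ.*-assoc c (δ i l) (f l)))
    (trans (*-sumFin n c _) (cong (c *_) (sumFin-δ i f)))

  module Construction {S : ℚ → Set} (sub : IsSubgroup S) (nontrivial : Nontrivial S)
    {u′ v m} (A : Matrix (suc u′) v) (Y : Fin (suc m) → QVec v) (rep : Fin (suc m) → Fin (suc u′))
    (first : ∀ i → FirstEntryOne (λ t → (A · Y t) i)) (dual : ∀ s t → (A · Y t) (rep s) ≡ δ s t)
    (d : ℚ) (d≢0 : d ≢ 0ℚ) (clears : ∀ t j → IsInteger (d * Y t j)) where

    u = suc u′
    open Blocks u
    open IsSubgroup sub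
    open Subgroup sub

    R : Fin u → QVec (suc m)
    R i t = (A · Y t) i

    R-rep : ∀ t (f : QVec (suc m)) → dot (R (rep t)) f ≡ f t
    R-rep t f = trans (sumFin-cong (suc m) (λ s → cong (_* f s) (dual t s))) (sumFin-δ t f)

    instance _ = ≢-nonZero d≢0

    -- Row k of B is the equation z_k = Σ_t R_kt z_(rep t), which is trivial for k = rep zero.
    B : Fin u → QVec u
    B k l = δ k l - dot (R k) (λ t → δ (rep t) l)

    dot-B : ∀ k z → dot (B k) z ≡ z k - dot (R k) (z ∘ rep)
    dot-B k z = begin
      sumFin u (λ l → (δ k l - c l) * z l)                            ≡⟨ sumFin-cong u (λ l → expand (δ k l) (c l) (z l)) ⟩
      sumFin u (λ l → δ k l * z l + (- 1ℚ) * (c l * z l))             ≡⟨ sumFin-+ u (λ l → δ k l * z l) (λ l → (- 1ℚ) * (c l * z l)) ⟩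
      sumFin u (λ l → δ k l * z l) + sumFin u (λ l → (- 1ℚ) * (c l * z l))
        ≡⟨ cong₂ _+_ (sumFin-δ k z) (*-sumFin u (- 1ℚ) (λ l → c l * z l)) ⟩
      z k + (- 1ℚ) * dot c z                                          ≡⟨ minus (z k) (dot c z) ⟩
      z k - dot c z                                                   ≡⟨ cong (λ q → z k - q) (dot-· (R k) (λ t → δ (rep t)) z) ⟨
      z k - dot (R k) (λ t → dot (δ (rep t)) z)                       ≡⟨ cong (λ q → z k - q) (sumFin-cong (suc m) (λ t → cong (R k t *_) (sumFin-δ (rep t) z))) ⟩
      z k - dot (R k) (z ∘ rep)                                       ∎
      where
      open ≡-Reasoning
      c : QVec u
      c l = dot (R k) (λ t → δ (rep t) l)
      expand : ∀ a b z → (a - b) * z ≡ a * z + (- 1ℚ) * (b * z)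
      expand = solve-∀ ℚ-ring
      minus : ∀ a b → a + (- 1ℚ) * b ≡ a - b
      minus = solve-∀ ℚ-ring

    -- Skipping the trivial equation of `rep zero` by `punchIn` leaves `u′` rows, one fewer than `A`
    -- has.
    spanRow : Fin u′ → QVec (3 ℕ.* u)
    spanRow a = blocks (B (punchIn (rep zero) a)) (λ _ → 0ℚ) (λ _ → 0ℚ)

    -- The equation z = d (x - y) with `x` and `y` in `S` forces `z` into d S, so that the rational
    -- vectors `Y` can be multiplied by `z` without leaving `S`.
    divisionRow : Fin u → QVec (3 ℕ.* u)
    divisionRow i = blocks (δ i) (λ l → (- d) * δ i l) (λ l → d * δ i l)

    D : Matrix (u′ ℕ.+ u) (3 ℕ.* u)
    D = [ spanRow , divisionRow ]′ ∘ splitAt u′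

    D-span : ∀ a → D (a ↑ˡ u) ≡ spanRow a
    D-span a = cong [ spanRow , divisionRow ]′ (Fin.splitAt-↑ˡ u′ a u)

    D-division : ∀ i → D (u′ ↑ʳ i) ≡ divisionRow i
    D-division i = cong [ spanRow , divisionRow ]′ (Fin.splitAt-↑ʳ u′ u i)

    dot-spanRow : ∀ a s → let k = punchIn (rep zero) a in
      dot (spanRow a) s ≡ s (zᵢ k) - dot (R k) (s ∘ zᵢ ∘ rep)
    dot-spanRow a s = begin
      dot (spanRow a) s                                                       ≡⟨ dot-blocks (B k) (λ _ → 0ℚ) (λ _ → 0ℚ) s ⟩
      dot (B k) (s ∘ zᵢ) + dot (λ _ → 0ℚ) (s ∘ xᵢ) + dot (λ _ → 0ℚ) (s ∘ yᵢ)
        ≡⟨ cong₂ (λ p q → dot (B k) (s ∘ zᵢ) + p + q) (vanish (s ∘ xᵢ)) (vanish (s ∘ yᵢ)) ⟩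
      dot (B k) (s ∘ zᵢ) + 0ℚ + 0ℚ                                            ≡⟨ trans (ℚ.+-identityʳ _) (ℚ.+-identityʳ _) ⟩
      dot (B k) (s ∘ zᵢ)                                                      ≡⟨ dot-B k (s ∘ zᵢ) ⟩
      s (zᵢ k) - dot (R k) (s ∘ zᵢ ∘ rep)                                     ∎
      where
      open ≡-Reasoning
      k = punchIn (rep zero) a
      vanish : ∀ f → dot (λ _ → 0ℚ) f ≡ 0ℚ
      vanish f = sumFin-zero u (λ i → ℚ.*-zeroˡ (f i))

    dot-divisionRow : ∀ i s → dot (divisionRow i) s ≡ s (zᵢ i) - d * (s (xᵢ i) - s (yᵢ i))
    dot-divisionRow i s = begin
      dot (divisionRow i) s                                       ≡⟨ dot-blocks (δ i) (λ l → (- d) * δ i l) (λ l → d * δ i l) s ⟩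
      dot (δ i) (s ∘ zᵢ) + dot (λ l → (- d) * δ i l) (s ∘ xᵢ) + dot (λ l → d * δ i l) (s ∘ yᵢ)
        ≡⟨ cong₂ _+_ (cong₂ _+_ (sumFin-δ i (s ∘ zᵢ)) (dot-δ-scaled (- d) i (s ∘ xᵢ))) (dot-δ-scaled d i (s ∘ yᵢ)) ⟩
      s (zᵢ i) + (- d) * s (xᵢ i) + d * s (yᵢ i)                  ≡⟨ regroup (s (zᵢ i)) d (s (xᵢ i)) (s (yᵢ i)) ⟩
      s (zᵢ i) - d * (s (xᵢ i) - s (yᵢ i))                        ∎
      where
      open ≡-Reasoning
      regroup : ∀ z d x y → z + (- d) * x + d * y ≡ z - d * (x - y)
      regroup = solve-∀ ℚ-ring

    difference-zero : ∀ {p q} → p ≡ q → p - q ≡ 0ℚ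
    difference-zero {p} refl = ℚ.+-inverseʳ p

    zero-difference : ∀ {p q} → p - q ≡ 0ℚ → p ≡ q
    zero-difference {p} {q} eq = trans (sym (readd p q)) (trans (cong (_+ q) eq) (ℚ.+-identityˡ q))
      where
      readd : ∀ p q → p - q + q ≡ p
      readd = solve-∀ ℚ-ring

    infixr 5 _◂_
    _◂_ : ℚ → QVec (suc m) → QVec (suc (suc m))
    (a ◂ r) zero    = a
    (a ◂ r) (suc t) = r t

    -- A parametrisation of some solutions of `D`: the extra leading parameter is the common value
    -- of all x, and y is that value minus z / d. It gives the x and y rows their leading 1; the z
    -- rows inherit theirs from `R`.
    E : Matrix (3 ℕ.* u) (suc (suc m))
    E = blocks (λ i → 0ℚ ◂ R i) (λ i → 1ℚ ◂ λ _ → 0ℚ) (λ i → 1ℚ ◂ λ t → (- (1/ d)) * R i t)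

    E-first : ∀ k → FirstEntryOne (E k)
    E-first = blocks-elim _ _ _ FirstEntryOne (λ i → inj₂ (refl , first i)) (λ _ → inj₁ refl) (λ _ → inj₁ refl)

    module _ (α : QVec (suc (suc m))) where
      s = E · α
      α′ = α ∘ suc

      s-z : ∀ i → s (zᵢ i) ≡ dot (R i) α′
      s-z i = trans (cong (λ r → dot r α) (blocks-z _ _ _ i)) (lead (α zero) (dot (R i) α′))
        where
        lead : ∀ a b → 0ℚ * a + b ≡ b
        lead = solve-∀ ℚ-ring

      s-x : ∀ i → s (xᵢ i) ≡ α zero
      s-x i = trans (cong (λ r → dot r α) (blocks-x _ _ _ i)) (trans
        (cong (λ q → 1ℚ * α zero + q) (sumFin-zero (suc m) (λ t → ℚ.*-zeroˡ (α′ t)))) (lead (α zero)))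
        where
        lead : ∀ a → 1ℚ * a + 0ℚ ≡ a
        lead = solve-∀ ℚ-ring

      s-y : ∀ i → s (yᵢ i) ≡ α zero - (1/ d) * s (zᵢ i)
      s-y i = begin
        s (yᵢ i)                                                        ≡⟨ cong (λ r → dot r α) (blocks-y _ _ _ i) ⟩
        1ℚ * α zero + sumFin (suc m) (λ t → (- (1/ d)) * R i t * α′ t)  ≡⟨ cong (λ q → 1ℚ * α zero + q) (sumFin-cong (suc m) (λ t → ℚ.*-assoc (- (1/ d)) (R i t) (α′ t))) ⟩
        1ℚ * α zero + sumFin (suc m) (λ t → (- (1/ d)) * (R i t * α′ t)) ≡⟨ cong (λ q → 1ℚ * α zero + q) (*-sumFin (suc m) (- (1/ d)) (λ t → R i t * α′ t)) ⟩
        1ℚ * α zero + (- (1/ d)) * dot (R i) α′                         ≡⟨ cong (λ q → 1ℚ * α zero + (- (1/ d)) * q) (s-z i) ⟨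
        1ℚ * α zero + (- (1/ d)) * s (zᵢ i)                             ≡⟨ lead (α zero) (1/ d) (s (zᵢ i)) ⟩
        α zero - (1/ d) * s (zᵢ i)                                      ∎
        where
        open ≡-Reasoning
        lead : ∀ a e z → 1ℚ * a + (- e) * z ≡ a - e * z
        lead = solve-∀ ℚ-ring

      span-holds : ∀ a → dot (spanRow a) s ≡ 0ℚ
      span-holds a = trans (dot-spanRow a s) (difference-zero (trans (s-z k)
        (sumFin-cong (suc m) (λ t → cong (R k t *_) (sym (trans (s-z (rep t)) (R-rep t α′)))))))
        where k = punchIn (rep zero) a

      division-holds : ∀ i → dot (divisionRow i) s ≡ 0ℚ
      division-holds i = trans (dot-divisionRow i s) (difference-zero (sym (begin
        d * (s (xᵢ i) - s (yᵢ i))                             ≡⟨ cong₂ (λ p q → d * (p - q)) (s-x i) (s-y i) ⟩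
        d * (α zero - (α zero - (1/ d) * s (zᵢ i)))           ≡⟨ simplify d (α zero) (1/ d) (s (zᵢ i)) ⟩
        (d * (1/ d)) * s (zᵢ i)                               ≡⟨ cong (_* s (zᵢ i)) (ℚ.*-inverseʳ d) ⟩
        1ℚ * s (zᵢ i)                                         ≡⟨ ℚ.*-identityˡ _ ⟩
        s (zᵢ i)                                              ∎)))
        where
        open ≡-Reasoning
        simplify : ∀ d a e z → d * (a - (a - e * z)) ≡ (d * e) * z
        simplify = solve-∀ ℚ-ring

      D-kernel : ∀ k → (D · s) k ≡ 0ℚ
      D-kernel k with splitAt u′ k
      ... | inj₁ a = span-holds a
      ... | inj₂ i = division-holds i

    D-kernelPR : KernelPR S D
    D-kernelPR k c = solve (firstEntries-IPR nontrivial E E-first k c)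
      where
      solve : (Σ (QVec (suc (suc m))) λ α → MonoIn S c (E · α)) →
        Σ (QVec (3 ℕ.* u)) λ x → (∀ i → (D · x) i ≡ 0ℚ) × MonoIn S c x
      solve (α , mono) = E · α , D-kernel α , mono

    -- The span equations make the z block the image under `A` of Σ_t z_(rep t) Y_t, and the
    -- division equations put this vector in `S`.
    D-solutions : ∀ (s : QVec (3 ℕ.* u)) → (∀ i → S (s i) × s i ≢ 0ℚ) → (∀ i → (D · s) i ≡ 0ℚ) →
      Σ (QVec v) λ y → (∀ j → S (y j)) × ¬ (∀ j → y j ≡ 0ℚ) × (∀ i → Σ (Fin (3 ℕ.* u)) λ k → (A · y) i ≡ s k)
    D-solutions s s∈ Ds≡0 = y , y∈ , y≢0 , λ i → zᵢ i , A·y i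
      where
      z = s ∘ zᵢ

      z-division : ∀ i → z i ≡ d * (s (xᵢ i) - s (yᵢ i))
      z-division i = zero-difference (trans (sym (dot-divisionRow i s))
        (trans (cong (λ r → dot r s) (sym (D-division i))) (Ds≡0 (u′ ↑ʳ i))))

      z-span : ∀ k → z k ≡ dot (R k) (z ∘ rep)
      z-span k with rep zero Fin.≟ k
      -- The equation omitted from `D` holds by duality.
      ... | yes refl   = sym (R-rep zero (z ∘ rep))
      ... | no r₀≢k = subst (λ k → z k ≡ dot (R k) (z ∘ rep)) (Fin.punchIn-punchOut r₀≢k)
        (zero-difference (trans (sym (dot-spanRow (punchOut r₀≢k) s))
          (trans (cong (λ r → dot r s) (sym (D-span (punchOut r₀≢k)))) (Ds≡0 (punchOut r₀≢k ↑ˡ u)))))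

      y : QVec v
      y j = dot (λ t → Y t j) (z ∘ rep)

      A·y : ∀ k → (A · y) k ≡ z k
      A·y k = trans (dot-· (A k) (λ j t → Y t j) (z ∘ rep)) (sym (z-span k))

      -- Each summand is the integer `d * Y t j` times the difference x - y at `rep t`, an element
      -- of `S`.
      y∈ : ∀ j → S (y j)
      y∈ j = sumFin-closed (suc m) λ t → subst S
        (trans (swap d (Y t j) (s (xᵢ (rep t)) - s (yᵢ (rep t)))) (cong (Y t j *_) (sym (z-division (rep t)))))
        (integer-multiple (clears t j)
          (+-closed (proj₁ (s∈ (xᵢ (rep t)))) (neg-closed (proj₁ (s∈ (yᵢ (rep t)))))))
        where
        swap : ∀ d q w → (d * q) * w ≡ q * (d * w)
        swap = solve-∀ ℚ-ring

      y≢0 : ¬ (∀ j → y j ≡ 0ℚ)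
      y≢0 y≡0 = proj₂ (s∈ (zᵢ zero)) (trans (sym (A·y zero))
        (sumFin-zero v (λ j → trans (cong (A zero j *_) (y≡0 j)) (ℚ.*-zeroʳ (A zero j)))))

  -- Assembly of the theorem.

  KernelMatrix : ∀ (S : ℚ → Set) {u v} → Matrix u v → ℕ → Set
  KernelMatrix S {u} {v} A j = Σ (Matrix (j ℕ.+ u) (3 ℕ.* u)) λ D → KernelPR S D ×
    (∀ (s : QVec (3 ℕ.* u)) → (∀ i → S (s i) × s i ≢ 0ℚ) → (∀ i → (D · s) i ≡ 0ℚ) →
      Σ (QVec v) λ y → (∀ j → S (y j)) × ¬ (∀ j → y j ≡ 0ℚ) × (∀ i → Σ (Fin (3 ℕ.* u)) λ k → (A · y) i ≡ s k))

  kernelMatrix : ∀ {S : ℚ → Set} → IsSubgroup S → Nontrivial S → ∀ {u v} (A : Matrix (suc u) v) →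
    FirstEntriesForm A (allFin (suc u)) → KernelMatrix S A u
  -- Without columns, row `zero` could not have a first nonzero entry.
  kernelMatrix sub nontrivial A record { size = zero ; first = first } = ⊥-elim (first (∈-allFin zero))
  kernelMatrix sub nontrivial A record { size = suc m ; Y = Y ; rep = rep ; first = first ; dual = dual } =
    construct (commonDenominator (cartesianProductWith Y (allFin (suc m)) (allFin _)))
    where
    construct : CommonDenominator (cartesianProductWith Y (allFin (suc m)) (allFin _)) → KernelMatrix _ A _
    construct C = D , D-kernelPR , D-solutions
      where
      module C = CommonDenominator C
      open Construction sub nontrivial A Y rep (λ i → first (∈-allFin i)) dual
        C.den C.den≢0 (λ t j → C.clears (∈-cartesianProductWith⁺ Y (∈-allFin t) (∈-allFin j)))

open RationalMatrices using (firstEntriesForm; kernelMatrix)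
open import Data.Nat using (_<_; _+_; _*_)

theorem2p11 : (S : ℚ → Set) → IsSubgroup S → Nontrivial S → Proper S →
  (u v : ℕ) (A : Matrix u v) → WeaklyIPR S A → RowsDependent A →
  Σ ℕ λ j → j < u × Σ (Matrix (j + u) (3 * u)) λ D → KernelPR S D ×
    (∀ (s : QVec (3 * u)) → (∀ i → S (s i) × s i ≢ 0ℚ) → (∀ i → (D · s) i ≡ 0ℚ) →
      Σ (QVec v) λ y → (∀ j → S (y j)) × ¬ (∀ j → y j ≡ 0ℚ) ×
        (∀ i → Σ (Fin (3 * u)) λ k → (A · y) i ≡ s k))
-- No j < 0 exists, but an empty family of rows has no nonzero coefficient to witness dependence.
theorem2p11 S sub nontrivial _ zero    v A ipr (_ , (() , _) , _)
theorem2p11 S sub nontrivial _ (suc u) v A ipr _ =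
  u , ℕ.n<1+n u , kernelMatrix sub nontrivial A (firstEntriesForm {S} A ipr)
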